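{- All trees on $n$ vertices are maximal elements in the poset $\mathcal{S}_n$.
   Context: All graphs are finite and simple. The chromatic symmetric function of a graph $G$ with vertices $v_1,\dots,v_n$ is $X_G=\sum_{\kappa}x_{\kappa(v_1)}\cdots x_{\kappa(v_n)}$, summed over all proper colorings $\kappa:V(G)\to\{1,2,3,\dots\}$; it is a homogeneous symmetric function of degree $n$ over $\mathbb{Q}$. Let $s_\lambda$ be the Schur symmetric functions; $[s_\lambda]F$ denotes the coefficient of $s_\lambda$ in $F$ expanded in this basis, and $F$ is Schur-positive if $[s_\lambda]F\ge 0$ for all $\lambda$. For connected graphs $G,H$ on $n$ vertices (for which $[s_{(1^n)}]X_G$ and $[s_{(1^n)}]X_H$ are positive), set $$X_s(G,H)=X_G-\frac{[s_{(1^n)}]X_G}{[s_{(1^n)}]X_H}X_H.$$ $\mathcal{S}_n$ is the poset whose elements are the equivalence classes of connected graphs on $n$ vertices under $G\sim H\iff X_G=X_H$, ordered by $G\geq_s H$ if and only if $X_s(G,H)$ is Schur-positive. An element $x$ of a poset is maximal if $y\leq x$ for every $y$ comparable to $x$. -}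

module Defs where

open import Data.Fin.Base using (Fin)
open import Data.Fin.Properties using (all?)
open import Data.Integer.Base using (+_)
open import Data.List.Base
  using (List; []; _∷_; [_]; _++_; length; map; filter; concat; concatMap;
         cartesianProductWith; foldr; replicate; upTo; zip)
open import Data.List.Membership.Propositional using (_∈_)
open import Data.List.Properties using (≡-dec)
open import Data.List.Relation.Unary.All as All using (All)
open import Data.List.Relation.Unary.Linked using (Linked; linked?)
open import Data.List.Relation.Unary.Unique.Propositional using (Unique)
open import Data.Nat.Base as ℕ using (ℕ; zero; suc)
open import Data.Nat.ListAction using (sum)
import Data.Nat.Properties as ℕₚ
open import Data.Product.Base using (Σ; Σ-syntax; _×_; _,_; proj₁; proj₂; uncurry)
open import Data.Rational.Base as ℚ using (ℚ; 0ℚ; NonZero; _÷_)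
open import Data.Sum.Base using (_⊎_)
open import Data.Vec.Base as Vec using (Vec; lookup; toList)
open import Function.Base using (_on_; flip)
open import Level as Level using (0ℓ; _⊔_)
open import Relation.Binary.Bundles.Raw using (RawRelation)
open import Relation.Binary.Construct.Closure.ReflexiveTransitive using (Star)
open import Relation.Binary.Core using (Rel)
open import Relation.Binary.Definitions using (Decidable; Symmetric; Irreflexive)
open import Relation.Binary.PropositionalEquality.Core
  using (_≡_; _≢_; sym; trans; cong; cong₂)
open import Relation.Nullary.Decidable using (Dec; map′; ¬?; _×-dec_; _→-dec_)
open import Relation.Nullary.Negation.Core using (¬_)

record Graph (n : ℕ) : Set₁ where
  infix 4 _~_ _~?_
  field
    _~_      : Rel (Fin n) 0ℓ
    _~?_     : Decidable _~_
    ~-sym    : Symmetric _~_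
    ~-irrefl : Irreflexive _≡_ _~_

-- A connected graph is non-empty by convention.

record Connected {n} (G : Graph n) : Set where
  open Graph G
  field
    nonEmpty : 0 ℕ.< n
    walk     : ∀ u v → Star _~_ u v

-- The cycle v – w₁ – … – wₖ – v, with k ≥ 2.

record Cycle {n} (G : Graph n) : Set where
  open Graph G
  field
    v        : Fin n
    ws       : List (Fin n)
    long     : 2 ℕ.≤ length ws
    distinct : Unique (v ∷ ws)
    closed   : Linked _~_ (v ∷ ws ++ [ v ])

record IsTree {n} (G : Graph n) : Set where
  field
    connected : Connected G
    acyclic   : ¬ Cycle G

-- Formal power series in the variables x₀, x₁, x₂, …
--
-- F (α₀ ∷ … ∷ αₖ₋₁ ∷ []) is the coefficient of x₀^α₀ ⋯ xₖ₋₁^αₖ₋₁ in F.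
-- Trailing zeros do not change the monomial; the series built below by
-- ∑x respect this.

Series : Set
Series = List ℕ → ℚ

infix 4 _≈_
_≈_ : Rel Series 0ℓ
F ≈ F′ = ∀ α → F α ≡ F′ α

infixl 6 _−_
_−_ : Series → Series → Series
(F − F′) α = F α ℚ.- F′ α

infixr 7 _·_
_·_ : ℚ → Series → Series
(q · F) α = q ℚ.* F α

-- The exponents of x₀, …, xₖ₋₁ in x_{i₁} ⋯ x_{iₘ}.

content : ℕ → List ℕ → List ℕ
content k is = map (λ i → length (filter (i ℕₚ.≟_) is)) (upTo k)

-- Given an infinite collection of words (i₁ … iₘ), where W k lists, with
-- multiplicity, those all of whose letters are < k, this is the sum of the
-- monomials x_{i₁} ⋯ x_{iₘ} over the collection.  A monomial in
-- x₀, …, xₖ₋₁ only arises from words listed in W k.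

∑x : (ℕ → List (List ℕ)) → Series
∑x W α = + length (filter (λ is → ≡-dec ℕₚ._≟_ (content k is) α) (W k)) ℚ./ 1
  where k = length α

vectors : ∀ {A : Set} → List A → (n : ℕ) → List (Vec A n)
vectors as zero    = [ Vec.[] ]
vectors as (suc n) = cartesianProductWith Vec._∷_ as (vectors as n)

module _ {n} (G : Graph n) where
  open Graph G

  Proper : Vec ℕ n → Set
  Proper κ = ∀ u v → u ~ v → lookup κ u ≢ lookup κ v

  proper? : ∀ κ → Dec (Proper κ)
  proper? κ = all? λ u → all? λ v →
    (u ~? v) →-dec ¬? (lookup κ u ℕₚ.≟ lookup κ v)

  X : Series
  X = ∑x λ k → map toList (filter proper? (vectors (upTo k) n))

record IsPartition (n : ℕ) (λs : List ℕ) : Set where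
  constructor isPartition
  field
    decreasing : Linked ℕ._≥_ λs
    positive   : All (1 ℕ.≤_) λs
    size       : sum λs ≡ n

isPartition? : ∀ n λs → Dec (IsPartition n λs)
isPartition? n λs = map′
  (λ (d , p , s) → isPartition d p s)
  (λ (isPartition d p s) → d , p , s)
  (linked? ℕₚ._≥?_ λs ×-dec All.all? (1 ℕₚ.≤?_) λs ×-dec (sum λs ℕₚ.≟ n))

-- A partition of n has at most n parts, each at most n.

partitions : ℕ → List (List ℕ)
partitions n = filter (isPartition? n)
  (concatMap (λ l → map toList (vectors (upTo (suc n)) l)) (upTo (suc n)))

-- A filling of a Young diagram is the list of its rows, from the longest
-- (top) row to the shortest.

Filling : Set
Filling = List (List ℕ)

-- All fillings of the given shape with entries < k.

fillings : ℕ → List ℕ → List Filling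
fillings k []       = [ [] ]
fillings k (r ∷ λs) =
  cartesianProductWith _∷_ (map toList (vectors (upTo k) r)) (fillings k λs)

-- zip truncates the upper row to the length of the lower one.

_Above_ : Rel (List ℕ) 0ℓ
r Above r′ = All (uncurry ℕ._<_) (zip r r′)

Semistandard : Filling → Set
Semistandard T = All (Linked ℕ._≤_) T × Linked _Above_ T

semistandard? : ∀ T → Dec (Semistandard T)
semistandard? T =
  All.all? (linked? ℕₚ._≤?_) T ×-dec
  linked? (λ r r′ → All.all? (uncurry ℕₚ._<?_) (zip r r′)) T

s : List ℕ → Series
s λs = ∑x λ k → map concat (filter semistandard? (fillings k λs))

-- Values of coeff at lists that are not partitions of n are irrelevant.

record SchurExpansion (n : ℕ) (F : Series) : Set where
  field
    coeff   : List ℕ → ℚ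
    expands : F ≈ λ α →
      foldr ℚ._+_ 0ℚ (map (λ λs → coeff λs ℚ.* s λs α) (partitions n))

infix 8 [s_]_
[s_]_ : ∀ {n F} → List ℕ → SchurExpansion n F → ℚ
[s λs ] E = SchurExpansion.coeff E λs

SchurPositive : ℕ → Series → Set
SchurPositive n F =
  Σ[ E ∈ SchurExpansion n F ] (∀ λs → λs ∈ partitions n → 0ℚ ℚ.≤ [s λs ] E)

1^ : ℕ → List ℕ
1^ n = replicate n 1

ConnectedGraph : ℕ → Set₁
ConnectedGraph n = Σ (Graph n) Connected

module _ {n : ℕ} where

  Xₛ : (G H : Graph n)
       (E : SchurExpansion n (X G)) (E′ : SchurExpansion n (X H)) →
       .{{NonZero ([s 1^ n ] E′)}} → Series
  Xₛ G H E E′ = X G − ([s 1^ n ] E ÷ [s 1^ n ] E′) · X H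

  -- Schur expansions exist and are unique, and connected graphs have a
  -- positive coefficient at 1^ n, so E, E′ and nz only serve to name the
  -- two coefficients.

  infix 4 _≥ₛ_
  _≥ₛ_ : Rel (Graph n) 0ℓ
  G ≥ₛ H =
    Σ[ E  ∈ SchurExpansion n (X G) ]
    Σ[ E′ ∈ SchurExpansion n (X H) ]
    Σ[ nz ∈ NonZero ([s 1^ n ] E′) ]
    SchurPositive n (Xₛ G H E E′ {{nz}})

  -- The relation is well defined on classes of graphs with equal X.

  private
    transport : ∀ {F F′} → F ≈ F′ → SchurExpansion n F → SchurExpansion n F′
    transport F≈F′ E = record
      { coeff   = SchurExpansion.coeff E
      ; expands = λ α → trans (sym (F≈F′ α)) (SchurExpansion.expands E α)
      }

  ≥ₛ-resp-≈ : ∀ {G G′ H H′ : Graph n} → X G ≈ X G′ → X H ≈ X H′ →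
              G ≥ₛ H → G′ ≥ₛ H′
  ≥ₛ-resp-≈ G≈ H≈ (E , E′ , nz , P , P≥0) =
    transport G≈ E , transport H≈ E′ , nz ,
    transport (λ α → cong₂ ℚ._-_ (G≈ α) (cong (q ℚ.*_) (H≈ α))) P , P≥0
    where q = ([s 1^ n ] E ÷ [s 1^ n ] E′) {{nz}}

-- Equivalence classes of graphs are represented by their members, with
-- equality of chromatic symmetric functions as the equality of 𝒮 n.

𝒮 : ℕ → RawRelation (Level.suc 0ℓ) 0ℓ 0ℓ
𝒮 n = record
  { Carrier = ConnectedGraph n
  ; _≈_     = λ G H → X (proj₁ G) ≈ X (proj₁ H)
  ; _∼_     = flip _≥ₛ_ on proj₁
  }

Maximal : ∀ {a ℓ₁ ℓ₂} (P : RawRelation a ℓ₁ ℓ₂) →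
          RawRelation.Carrier P → Set (a ⊔ ℓ₂)
Maximal P x = ∀ y → (x ≤ y ⊎ y ≤ x) → y ≤ x
  where open RawRelation P renaming (_∼_ to _≤_)

{-# OPTIONS --safe #-}

-- Suppose H ≥ₛ T and let q be the ratio of the coefficients of s_{1ⁿ} in X_H
-- and X_T.  The coefficient of x₀ ⋯ xₙ₋₁ is the same number n! in X_H and in
-- X_T, so it is n! (1 − q) in Xₛ(H,T); it is also a positive combination of
-- the Schur coefficients of Xₛ(H,T), because every Schur function contains the
-- monomial x₀ ⋯ xₙ₋₁.  So q ≤ 1, and q = 1 only if X_H = X_T.
--
-- Conversely q ≥ 1.  Put the first m variables equal to 1, the others equal to
-- 0, and extrapolate the resulting polynomial in m to m = −1.  By branching
-- this kills every s_λ with λ ≠ (1ⁿ), so q is the ratio of the values of the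
-- chromatic polynomials at −1.  Up to the sign (−1)ⁿ these are at least 2ⁿ⁻¹ for
-- every connected graph, by deletion and contraction, and 2ⁿ⁻¹ for a tree.

module Submission where

open import Defs
open import Data.Bool.Base using (true; false; if_then_else_)
open import Data.Fin.Base using (Fin; zero; suc)
import Data.Fin.Properties as Finₚ
import Data.Integer.Base as ℤ
import Data.Integer.Properties as ℤₚ
open import Data.List.Base
  using (List; []; _∷_; [_]; _++_; length; map; filter; cartesianProductWith;
         foldr; replicate; upTo; concat; concatMap; zip; allFin)
open import Data.List.Membership.Propositional using (_∈_; _∉_)
import Data.List.Membership.Propositional.Properties as ∈ₚ
open import Data.List.Membership.Propositional.Properties.WithK using (unique∧set⇒bag)
import Data.List.Properties as Listₚ
open import Data.List.Relation.Binary.BagAndSetEquality using (∼bag⇒↭)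
open import Data.List.Relation.Binary.Permutation.Propositional as Perm using (_↭_)
open import Data.List.Relation.Unary.All as All using (All; []; _∷_)
import Data.List.Relation.Unary.All.Properties as Allₚ
open import Data.List.Relation.Unary.Any using (here; there; any?)
open import Data.List.Relation.Unary.Linked as Linked using (Linked; []; [-]; _∷_)
open import Data.List.Relation.Unary.Unique.Propositional using (Unique; []; _∷_)
import Data.List.Relation.Unary.Unique.Propositional.Properties as Uniqueₚ
open import Data.Nat.Base as ℕ using (ℕ; zero; suc; z≤n; s≤s)
open import Data.Nat.ListAction using (sum)
import Data.Nat.Properties as ℕₚ
open import Data.Product.Base using (Σ-syntax; ∃; _×_; _,_; proj₁; proj₂; uncurry)
open import Data.Rational.Base as ℚ using (ℚ; 0ℚ; 1ℚ; _+_; _*_; _-_; -_; _≤_; _<_)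
import Data.Rational.Properties as ℚₚ
open import Data.Rational.Solver using (module +-*-Solver)
import Data.Rational.Unnormalised.Base as ℚᵘ
import Data.Rational.Unnormalised.Properties as ℚᵘₚ
open import Data.Sum.Base using (_⊎_; inj₁; inj₂)
open import Data.Unit.Base using (⊤; tt)
open import Data.Vec.Base as Vec using (Vec; []; _∷_; lookup; toList; fromList)
import Data.Vec.Membership.DecPropositional as DecMembership
open import Data.Vec.Membership.Propositional using () renaming (_∈_ to _∈ᵥ_; _∉_ to _∉ᵥ_)
open import Data.Vec.Membership.Propositional.Properties using (∈-lookup)
import Data.Vec.Properties as Vecₚ
open import Data.Vec.Relation.Unary.Any as VecAny using (here; there)
open import Data.Vec.Relation.Unary.Any.Properties using (lookup-index)
open import Function.Base using (_∘_; id)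
open import Function.Bundles using (mk⇔)
open import Relation.Binary.Construct.Closure.ReflexiveTransitive
  using (Star; _◅_) renaming (ε to done)
open import Relation.Binary.PropositionalEquality
  using (_≡_; _≢_; refl; sym; trans; cong; cong₂; subst; module ≡-Reasoning)
open import Relation.Nullary.Decidable using (Dec; yes; no; does; ¬?; _×-dec_; _→-dec_)
open import Relation.Nullary.Negation using (¬_; contradiction)

open +-*-Solver using (solve; _:=_; _:+_; _:*_; _:-_; :-_; con)
open ≡-Reasoning

-- Why -1: extrapolated to m = -1, the number of semistandard tableaux of shape λ on m letters
-- becomes, up to sign, the number of tableaux of the transposed shape on a single letter, which is
-- zero unless the transposed shape is one row.
--
-- No polynomials are constructed. `Ext` carries a degree bound and the value at -1 together through
-- iterated differences, using (Δf)(-1) = f(0) - f(-1). Branching fits this form, since it writes Δ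
-- of a tableau count as a sum over smaller shapes.
--
-- On the graph side the obstacle is that contraction creates parallel edges and changes the vertex
-- set. Hence the `Layered` graphs: edges are removed only at the newest vertex, contraction
-- eliminates that vertex, and neighbour lists may have repetitions. A connected graph is put into
-- this form by growing it so that each new vertex has a neighbour among the older ones. Every new
-- vertex then at least doubles the count; in a tree the older neighbour is unique, and the count
-- doubles exactly.

private variable
  A B C : Set
  P Q Q′ : Set

-- Indicators and finite sums

𝟙 : Dec P → ℚ
𝟙 d = if does d then 1ℚ else 0ℚ

𝟙-yes : (d : Dec P) → P → 𝟙 d ≡ 1ℚ
𝟙-yes (yes _) _ = refl
𝟙-yes (no ¬p) p = contradiction p ¬p

𝟙-no : (d : Dec P) → ¬ P → 𝟙 d ≡ 0ℚ
𝟙-no (yes p) ¬p = contradiction p ¬p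
𝟙-no (no _)  _  = refl

𝟙-cong : (d : Dec P) (e : Dec Q) → (P → Q) → (Q → P) → 𝟙 d ≡ 𝟙 e
𝟙-cong (yes p) e f g = sym (𝟙-yes e (f p))
𝟙-cong (no ¬p) e f g = sym (𝟙-no e (¬p ∘ g))

𝟙-× : (d : Dec P) (e : Dec Q) (r : Dec Q′) → (P → Q × Q′) → (Q → Q′ → P) →
      𝟙 d ≡ 𝟙 e * 𝟙 r
𝟙-× d (yes q) r f g = trans (𝟙-cong d r (proj₂ ∘ f) (g q)) (sym (ℚₚ.*-identityˡ (𝟙 r)))
𝟙-× d (no ¬q) r f g = trans (𝟙-no d (¬q ∘ proj₁ ∘ f)) (sym (ℚₚ.*-zeroˡ (𝟙 r)))

𝟙-nonNeg : (d : Dec P) → 0ℚ ≤ 𝟙 d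
𝟙-nonNeg (yes _) = ℚₚ.nonNegative⁻¹ 1ℚ
𝟙-nonNeg (no _)  = ℚₚ.≤-refl

∑ : List A → (A → ℚ) → ℚ
∑ xs f = foldr _+_ 0ℚ (map f xs)

syntax ∑ xs (λ x → e) = ∑[ x ∈ xs ] e
infix 5 ∑

∑-cong-∈ : ∀ (xs : List A) {f g : A → ℚ} → (∀ {x} → x ∈ xs → f x ≡ g x) → ∑ xs f ≡ ∑ xs g
∑-cong-∈ []       eq = refl
∑-cong-∈ (x ∷ xs) eq = cong₂ _+_ (eq (here refl)) (∑-cong-∈ xs (eq ∘ there))

∑-cong : ∀ (xs : List A) {f g : A → ℚ} → (∀ x → f x ≡ g x) → ∑ xs f ≡ ∑ xs g
∑-cong xs eq = ∑-cong-∈ xs (λ {x} _ → eq x)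

∑-zero : ∀ (xs : List A) → (∑[ x ∈ xs ] 0ℚ) ≡ 0ℚ
∑-zero []       = refl
∑-zero (x ∷ xs) = trans (ℚₚ.+-identityˡ (∑[ x ∈ xs ] 0ℚ)) (∑-zero xs)

∑-vanish : ∀ (xs : List A) {f : A → ℚ} → (∀ {x} → x ∈ xs → f x ≡ 0ℚ) → ∑ xs f ≡ 0ℚ
∑-vanish xs eq = trans (∑-cong-∈ xs eq) (∑-zero xs)

∑-+ : ∀ (xs : List A) (f g : A → ℚ) → (∑[ x ∈ xs ] (f x + g x)) ≡ ∑ xs f + ∑ xs g
∑-+ []       f g = refl
∑-+ (x ∷ xs) f g = trans (cong (f x + g x +_) (∑-+ xs f g))
  (solve 4 (λ a b c d → a :+ b :+ (c :+ d) := a :+ c :+ (b :+ d)) refl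
    (f x) (g x) (∑ xs f) (∑ xs g))

∑-*ˡ : ∀ c (xs : List A) (f : A → ℚ) → (∑[ x ∈ xs ] (c * f x)) ≡ c * ∑ xs f
∑-*ˡ c []       f = sym (ℚₚ.*-zeroʳ c)
∑-*ˡ c (x ∷ xs) f = trans (cong (c * f x +_) (∑-*ˡ c xs f))
  (sym (ℚₚ.*-distribˡ-+ c (f x) (∑ xs f)))

∑-*ʳ : ∀ c (xs : List A) (f : A → ℚ) → (∑[ x ∈ xs ] (f x * c)) ≡ ∑ xs f * c
∑-*ʳ c xs f = trans (∑-cong xs (λ x → ℚₚ.*-comm (f x) c))
  (trans (∑-*ˡ c xs f) (ℚₚ.*-comm c (∑ xs f)))

∑-swap : ∀ (xs : List A) (ys : List B) (f : A → B → ℚ) →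
         (∑[ x ∈ xs ] ∑[ y ∈ ys ] f x y) ≡ (∑[ y ∈ ys ] ∑[ x ∈ xs ] f x y)
∑-swap []       ys f = sym (∑-zero ys)
∑-swap (x ∷ xs) ys f = trans (cong (∑ ys (f x) +_) (∑-swap xs ys f))
  (sym (∑-+ ys (f x) (λ y → ∑[ z ∈ xs ] f z y)))

∑-++ : ∀ (xs ys : List A) (f : A → ℚ) → ∑ (xs ++ ys) f ≡ ∑ xs f + ∑ ys f
∑-++ []       ys f = sym (ℚₚ.+-identityˡ (∑ ys f))
∑-++ (x ∷ xs) ys f = trans (cong (f x +_) (∑-++ xs ys f))
  (sym (ℚₚ.+-assoc (f x) (∑ xs f) (∑ ys f)))

∑-map : ∀ (h : A → B) (xs : List A) (f : B → ℚ) → ∑ (map h xs) f ≡ ∑ xs (f ∘ h)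
∑-map h xs f = cong (foldr _+_ 0ℚ) (sym (Listₚ.map-∘ xs))

∑-× : ∀ (h : A → B → C) (xs : List A) (ys : List B) (f : C → ℚ) →
      ∑ (cartesianProductWith h xs ys) f ≡ (∑[ x ∈ xs ] ∑[ y ∈ ys ] f (h x y))
∑-× h []       ys f = refl
∑-× h (x ∷ xs) ys f = trans (∑-++ (map (h x) ys) _ f)
  (cong₂ _+_ (∑-map (h x) ys f) (∑-× h xs ys f))

∑-filter : {P : A → Set} (P? : ∀ x → Dec (P x)) (xs : List A) (f : A → ℚ) →
           ∑ (filter P? xs) f ≡ (∑[ x ∈ xs ] (𝟙 (P? x) * f x))
∑-filter P? []       f = refl
∑-filter P? (x ∷ xs) f with P? x
... | yes _ = cong₂ _+_ (sym (ℚₚ.*-identityˡ (f x))) (∑-filter P? xs f)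
... | no  _ = trans (∑-filter P? xs f)
  (sym (trans (cong (_+ rest) (ℚₚ.*-zeroˡ (f x))) (ℚₚ.+-identityˡ rest)))
  where rest = ∑[ y ∈ xs ] (𝟙 (P? y) * f y)

∑-↭ : ∀ {xs ys : List A} (f : A → ℚ) → xs ↭ ys → ∑ xs f ≡ ∑ ys f
∑-↭ f Perm.refl         = refl
∑-↭ f (Perm.prep x p)   = cong (f x +_) (∑-↭ f p)
∑-↭ {ys = _ ∷ _ ∷ ys} f (Perm.swap x y p) = trans (cong (λ s → f x + (f y + s)) (∑-↭ f p))
  (solve 3 (λ a b c → a :+ (b :+ c) := b :+ (a :+ c)) refl (f x) (f y) (∑ ys f))
∑-↭ f (Perm.trans p q)  = trans (∑-↭ f p) (∑-↭ f q)

∑-nonNeg : ∀ (xs : List A) {f : A → ℚ} → (∀ {x} → x ∈ xs → 0ℚ ≤ f x) → 0ℚ ≤ ∑ xs f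
∑-nonNeg []       f≥0 = ℚₚ.≤-refl
∑-nonNeg (x ∷ xs) f≥0 = ℚₚ.+-mono-≤ (f≥0 (here refl)) (∑-nonNeg xs (f≥0 ∘ there))

∑-≥-term : ∀ (xs : List A) {f : A → ℚ} → (∀ {x} → x ∈ xs → 0ℚ ≤ f x) →
           ∀ {x} → x ∈ xs → f x ≤ ∑ xs f
∑-≥-term (x ∷ xs) {f} f≥0 (here refl) = ℚₚ.≤-trans (ℚₚ.≤-reflexive (sym (ℚₚ.+-identityʳ (f x))))
  (ℚₚ.+-monoʳ-≤ (f x) (∑-nonNeg xs (f≥0 ∘ there)))
∑-≥-term (y ∷ xs) {f} f≥0 (there x∈) = ℚₚ.≤-trans (∑-≥-term xs (f≥0 ∘ there) x∈)
  (ℚₚ.≤-trans (ℚₚ.≤-reflexive (sym (ℚₚ.+-identityˡ (∑ xs f))))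
    (ℚₚ.+-monoˡ-≤ (∑ xs f) (f≥0 (here refl))))

∑-𝟙≟ : {_≟_ : ∀ (x y : A) → Dec (x ≡ y)} {xs : List A} {y : A} →
       Unique xs → y ∈ xs → (∑[ x ∈ xs ] 𝟙 (y ≟ x)) ≡ 1ℚ
∑-𝟙≟ {_≟_ = _≟_} (x∉ ∷ _) (here refl) = cong₂ _+_ (𝟙-yes (_ ≟ _) refl)
  (∑-vanish _ (λ x∈ → 𝟙-no (_ ≟ _) (All.lookup x∉ x∈)))
∑-𝟙≟ {_≟_ = _≟_} (x∉ ∷ u) (there y∈) = trans
  (cong₂ _+_ (𝟙-no (_ ≟ _) (λ { refl → All.lookup x∉ y∈ refl })) (∑-𝟙≟ {_≟_ = _≟_} u y∈))
  (ℚₚ.+-identityˡ 1ℚ)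

∑-upTo-first : ∀ n (f : ℕ → ℚ) → ∑ (upTo (suc n)) f ≡ f 0 + ∑ (upTo n) (f ∘ suc)
∑-upTo-first n f = cong (f 0 +_) (trans
  (cong (λ xs → ∑ xs f) (sym (Listₚ.map-upTo suc n))) (∑-map suc (upTo n) f))

∑-upTo-last : ∀ n (f : ℕ → ℚ) → ∑ (upTo (suc n)) f ≡ ∑ (upTo n) f + f n
∑-upTo-last n f = begin
  ∑ (upTo (suc n)) f           ≡⟨ cong (λ xs → ∑ xs f) (sym (Listₚ.upTo-∷ʳ n)) ⟩
  ∑ (upTo n ++ [ n ]) f        ≡⟨ ∑-++ (upTo n) [ n ] f ⟩
  ∑ (upTo n) f + (f n + 0ℚ)    ≡⟨ cong (∑ (upTo n) f +_) (ℚₚ.+-identityʳ (f n)) ⟩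
  ∑ (upTo n) f + f n           ∎

ι : ℕ → ℚ
ι n = ℤ.+ n ℚ./ 1

-- Division by 1 normalises by a gcd that is stuck on a variable `n`, so the equation is checked on
-- unnormalised representatives.
ι-suc : ∀ n → ι (suc n) ≡ 1ℚ + ι n
ι-suc n = ℚₚ.toℚᵘ-injective (R.begin
  ℚ.toℚᵘ (ι (suc n))                      R.≈⟨ ℚₚ.toℚᵘ-fromℚᵘ (ℚᵘ.mkℚᵘ (ℤ.+ suc n) 0) ⟩
  ℚᵘ.mkℚᵘ (ℤ.+ suc n) 0
    R.≈⟨ ℚᵘ.*≡* (sym (cong (λ i → (ℤ.1ℤ ℤ.+ i) ℤ.* ℤ.1ℤ) (ℤₚ.*-identityʳ (ℤ.+ n)))) ⟩
  ℚ.toℚᵘ 1ℚ ℚᵘ.+ ℚᵘ.mkℚᵘ (ℤ.+ n) 0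
    R.≈⟨ ℚᵘₚ.+-congʳ (ℚ.toℚᵘ 1ℚ) (ℚᵘₚ.≃-sym (ℚₚ.toℚᵘ-fromℚᵘ (ℚᵘ.mkℚᵘ (ℤ.+ n) 0))) ⟩
  ℚ.toℚᵘ 1ℚ ℚᵘ.+ ℚ.toℚᵘ (ι n)             R.≈⟨ ℚₚ.toℚᵘ-homo-+ 1ℚ (ι n) ⟨
  ℚ.toℚᵘ (1ℚ + ι n)                       R.∎)
  where module R = ℚᵘₚ.≃-Reasoning

∑-1 : ∀ (xs : List A) → (∑[ x ∈ xs ] 1ℚ) ≡ ι (length xs)
∑-1 []       = refl
∑-1 (x ∷ xs) = trans (cong (1ℚ +_) (∑-1 xs)) (sym (ι-suc (length xs)))

-- Ext d f c means that f is a polynomial of degree < d, and that c is its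
-- value at −1.

Δ : (ℕ → ℚ) → ℕ → ℚ
Δ f m = f (suc m) - f m

Ext : ℕ → (ℕ → ℚ) → ℚ → Set
Ext zero    f c = (∀ m → f m ≡ 0ℚ) × c ≡ 0ℚ
Ext (suc d) f c = Ext d (Δ f) (f 0 - c)

Ext-cong : ∀ d {f g c e} → (∀ m → f m ≡ g m) → c ≡ e → Ext d f c → Ext d g e
Ext-cong zero    f≗g refl (f≡0 , c≡0) = (λ m → trans (sym (f≗g m)) (f≡0 m)) , c≡0
Ext-cong (suc d) f≗g refl p =
  Ext-cong d (λ m → cong₂ _-_ (f≗g (suc m)) (f≗g m)) (cong (_- _) (f≗g 0)) p

-- By induction `Δ f` has only one value at -1, and subtracting it from `f 0` recovers the value of
-- `f`.
Ext-unique : ∀ d {f c e} → Ext d f c → Ext d f e → c ≡ e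
Ext-unique zero    (_ , c≡0) (_ , e≡0) = trans c≡0 (sym e≡0)
Ext-unique (suc d) {f} {c} {e} p q = begin
  c                ≡⟨ solve 2 (λ a c → c := a :- (a :- c)) refl (f 0) c ⟩
  f 0 - (f 0 - c)  ≡⟨ cong (_-_ (f 0)) (Ext-unique d p q) ⟩
  f 0 - (f 0 - e)  ≡⟨ solve 2 (λ a c → a :- (a :- c) := c) refl (f 0) e ⟩
  e                ∎

Ext-0 : ∀ d → Ext d (λ _ → 0ℚ) 0ℚ
Ext-0 zero    = (λ _ → refl) , refl
Ext-0 (suc d) = Ext-0 d

Ext-+ : ∀ d {f g c e} → Ext d f c → Ext d g e → Ext d (λ m → f m + g m) (c + e)
Ext-+ zero    (f≡0 , c≡0) (g≡0 , e≡0) = (λ m → cong₂ _+_ (f≡0 m) (g≡0 m)) , cong₂ _+_ c≡0 e≡0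
Ext-+ (suc d) {f} {g} {c} {e} p q = Ext-cong d
  (λ m → lemma (f (suc m)) (f m) (g (suc m)) (g m)) (lemma (f 0) c (g 0) e) (Ext-+ d p q)
  where
  lemma : ∀ a b c d → (a - b) + (c - d) ≡ (a + c) - (b + d)
  lemma = solve 4 (λ a b c d → (a :- b) :+ (c :- d) := (a :+ c) :- (b :+ d)) refl

Ext-* : ∀ d k {f c} → Ext d f c → Ext d (λ m → k * f m) (k * c)
Ext-* zero    k (f≡0 , c≡0) =
  (λ m → trans (cong (k *_) (f≡0 m)) (ℚₚ.*-zeroʳ k)) , trans (cong (k *_) c≡0) (ℚₚ.*-zeroʳ k)
Ext-* (suc d) k {f} {c} p = Ext-cong d (λ m → lemma (f (suc m)) (f m)) (lemma (f 0) c) (Ext-* d k p)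
  where
  lemma : ∀ a b → k * (a - b) ≡ k * a - k * b
  lemma = solve 3 (λ k a b → k :* (a :- b) := k :* a :- k :* b) refl k

Ext-- : ∀ d {f g c e} → Ext d f c → Ext d g e → Ext d (λ m → f m - g m) (c - e)
Ext-- d {f} {g} {c} {e} p q = Ext-cong d (λ m → lemma (f m) (g m)) (lemma c e) (Ext-+ d p (Ext-* d (- 1ℚ) q))
  where
  lemma : ∀ a b → a + (- 1ℚ) * b ≡ a - b
  lemma = solve 2 (λ a b → a :+ con (- 1ℚ) :* b := a :- b) refl

Ext-∑ : ∀ d (xs : List A) {f : A → ℕ → ℚ} {c : A → ℚ} →
        (∀ {x} → x ∈ xs → Ext d (f x) (c x)) → Ext d (λ m → ∑[ x ∈ xs ] f x m) (∑ xs c)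
Ext-∑ d []       p = Ext-0 d
Ext-∑ d (x ∷ xs) p = Ext-+ d (p (here refl)) (Ext-∑ d xs (p ∘ there))

Ext-weaken : ∀ d {f c} → Ext d f c → Ext (suc d) f c
Ext-weaken zero    (f≡0 , c≡0) =
  (λ m → cong₂ _-_ (f≡0 (suc m)) (f≡0 m)) , cong₂ _-_ (f≡0 0) c≡0
Ext-weaken (suc d) p = Ext-weaken d p

-- Shifting moves the point -1 to 0. The recursive call has the required type by computation: `Δ`
-- commutes with the shift, and `Δ f 0` is `f 1 - f 0`.
Ext-shift : ∀ d {f c} → Ext d f c → Ext d (f ∘ suc) (f 0)
Ext-shift zero    (f≡0 , _) = f≡0 ∘ suc , f≡0 0
Ext-shift (suc d) p = Ext-shift d p

-- Product rule: Δ(m f) = f(m + 1) + m Δf, where the first summand is a shift and the second falls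
-- under the induction. The factor m takes the value -1 at -1, whence `- c`.
Ext-ι* : ∀ d {f c} → Ext d f c → Ext (suc d) (λ m → ι m * f m) (- c)
Ext-ι* zero (f≡0 , refl) = Ext-cong 1 {c = 0ℚ}
  (λ m → sym (trans (cong (ι m *_) (f≡0 m)) (ℚₚ.*-zeroʳ (ι m)))) refl (Ext-0 1)
Ext-ι* (suc d) {f} {c} p = Ext-cong (suc d)
  (λ m → trans
    (solve 3 (λ a b i → a :+ i :* (a :- b) := (con 1ℚ :+ i) :* a :- i :* b) refl (f (suc m)) (f m) (ι m))
    (cong (λ i → i * f (suc m) - ι m * f m) (sym (ι-suc m))))
  (solve 2 (λ a c → a :+ (:- (a :- c)) := con 0ℚ :* a :- (:- c)) refl (f 0) c)
  (Ext-+ (suc d) {f ∘ suc} {λ m → ι m * Δ f m} {f 0} { - (f 0 - c)}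
    (Ext-shift (suc d) {f} {c} p) (Ext-ι* d {Δ f} {f 0 - c} p))

-- Words

lookup∈⇒∈-vectors : ∀ {as : List A} {n} (κ : Vec A n) → (∀ i → lookup κ i ∈ as) → κ ∈ vectors as n
lookup∈⇒∈-vectors []      _ = here refl
lookup∈⇒∈-vectors (a ∷ κ) p = ∈ₚ.∈-cartesianProductWith⁺ Vec._∷_ (p zero) (lookup∈⇒∈-vectors κ (p ∘ suc))

∈-vectors⇒lookup∈ : ∀ {as : List A} {n} {κ : Vec A n} → κ ∈ vectors as n → ∀ i → lookup κ i ∈ as
∈-vectors⇒lookup∈ {as = as} {suc n} κ∈ i
  with ∈ₚ.∈-cartesianProductWith⁻ Vec._∷_ as (vectors as n) κ∈
... | a , κ′ , a∈ , κ′∈ , refl with i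
...   | zero  = a∈
...   | suc j = ∈-vectors⇒lookup∈ κ′∈ j

vectors-unique : ∀ {as : List A} → Unique as → ∀ n → Unique (vectors as n)
vectors-unique u zero    = [] ∷ []
vectors-unique u (suc n) =
  Uniqueₚ.cartesianProductWith⁺ Vec._∷_ Vecₚ.∷-injective u (vectors-unique u n)

words : List A → ℕ → List (List A)
words as n = map toList (vectors as n)

words-unique : ∀ {as : List A} → Unique as → ∀ n → Unique (words as n)
words-unique u n = Uniqueₚ.map⁺
  (λ {κ} {κ′} eq → trans (sym (Vecₚ.cast-is-id refl κ)) (Vecₚ.toList-injective refl κ κ′ eq))
  (vectors-unique u n)

All∈⇒∈-words : ∀ {as xs : List A} → All (_∈ as) xs → xs ∈ words as (length xs)
All∈⇒∈-words {as = as} {xs} p =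
  subst (_∈ words as (length xs)) (Vecₚ.toList∘fromList xs)
    (∈ₚ.∈-map⁺ toList (lookup∈⇒∈-vectors (fromList xs) (lookup∈ p)))
  where
  lookup∈ : ∀ {xs} → All (_∈ as) xs → ∀ i → lookup (fromList xs) i ∈ as
  lookup∈ (p ∷ _)  zero    = p
  lookup∈ (_ ∷ ps) (suc i) = lookup∈ ps i

∈-words⇒length : ∀ {as xs : List A} {n} → xs ∈ words as n → length xs ≡ n
∈-words⇒length xs∈ with ∈ₚ.∈-map⁻ toList xs∈
... | κ , _ , refl = Vecₚ.length-toList κ

∈-words⇒All∈ : ∀ {as xs : List A} {n} → xs ∈ words as n → All (_∈ as) xs
∈-words⇒All∈ {as = as} xs∈ with ∈ₚ.∈-map⁻ toList xs∈
... | κ , κ∈ , refl = go κ (∈-vectors⇒lookup∈ κ∈)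
  where
  go : ∀ {n} (κ : Vec _ n) → (∀ i → lookup κ i ∈ as) → All (_∈ as) (toList κ)
  go []      p = []
  go (a ∷ κ) p = p zero ∷ go κ (p ∘ suc)

-- Series as counting functions

content-≟ : ∀ k (is α : List ℕ) → Dec (content k is ≡ α)
content-≟ k is α = Listₚ.≡-dec ℕₚ._≟_ (content k is) α

∑x-𝟙 : ∀ W α {k} → length α ≡ k → ∑x W α ≡ (∑[ w ∈ W k ] 𝟙 (content-≟ k w α))
∑x-𝟙 W α {k} refl = begin
  ι (length (filter (λ w → content-≟ k w α) (W k)))
    ≡⟨ sym (∑-1 (filter (λ w → content-≟ k w α) (W k))) ⟩
  ∑ (filter (λ w → content-≟ k w α) (W k)) (λ _ → 1ℚ)
    ≡⟨ ∑-filter (λ w → content-≟ k w α) (W k) (λ _ → 1ℚ) ⟩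
  (∑[ w ∈ W k ] (𝟙 (content-≟ k w α) * 1ℚ))
    ≡⟨ ∑-cong (W k) (λ w → ℚₚ.*-identityʳ (𝟙 (content-≟ k w α))) ⟩
  (∑[ w ∈ W k ] 𝟙 (content-≟ k w α))                       ∎

-- For F homogeneous of degree n this is F(1, …, 1), with m variables.

total : ℕ → Series → ℕ → ℚ
total n F m = ∑ (words (upTo (suc n)) m) F

-- A word of length at most n has exponents at most n, so its content occurs exactly once in the box
-- of exponent vectors over which `total` sums; exchanging the two sums counts each word once.
total-∑x : ∀ n W m → (∀ {w} → w ∈ W m → length w ℕ.≤ n) → total n (∑x W) m ≡ ι (length (W m))
total-∑x n W m short = begin
  total n (∑x W) m
    ≡⟨ ∑-cong-∈ box (λ {α} α∈ → ∑x-𝟙 W α (∈-words⇒length α∈)) ⟩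
  (∑[ α ∈ box ] ∑[ w ∈ W m ] 𝟙 (content-≟ m w α))
    ≡⟨ ∑-swap box (W m) (λ α w → 𝟙 (content-≟ m w α)) ⟩
  (∑[ w ∈ W m ] ∑[ α ∈ box ] 𝟙 (content-≟ m w α))
    ≡⟨ ∑-cong-∈ (W m) (λ {w} w∈ → ∑-𝟙≟ {_≟_ = Listₚ.≡-dec ℕₚ._≟_} (words-unique (Uniqueₚ.upTo⁺ (suc n)) m)
         (content∈ w (short w∈))) ⟩
  (∑[ w ∈ W m ] 1ℚ)
    ≡⟨ ∑-1 (W m) ⟩
  ι (length (W m)) ∎
  where
  box = words (upTo (suc n)) m
  content∈ : ∀ w → length w ℕ.≤ n → content m w ∈ box
  content∈ w w≤n = subst (λ k → content m w ∈ words (upTo (suc n)) k)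
    (trans (Listₚ.length-map _ (upTo m)) (Listₚ.length-upTo m))
    (All∈⇒∈-words (Allₚ.map⁺ (All.universal
      (λ i → ∈ₚ.∈-upTo⁺ (s≤s (ℕₚ.≤-trans (Listₚ.length-filter (i ℕₚ.≟_) w) w≤n))) (upTo m))))

ι-length-filter : ∀ {P : A → Set} (P? : ∀ x → Dec (P x)) (f : A → B) xs →
                  ι (length (map f (filter P? xs))) ≡ (∑[ x ∈ xs ] 𝟙 (P? x))
ι-length-filter P? f xs = begin
  ι (length (map f (filter P? xs)))  ≡⟨ cong ι (Listₚ.length-map f (filter P? xs)) ⟩
  ι (length (filter P? xs))          ≡⟨ sym (∑-1 (filter P? xs)) ⟩
  ∑ (filter P? xs) (λ _ → 1ℚ)        ≡⟨ ∑-filter P? xs (λ _ → 1ℚ) ⟩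
  (∑[ x ∈ xs ] (𝟙 (P? x) * 1ℚ))      ≡⟨ ∑-cong xs (λ x → ℚₚ.*-identityʳ (𝟙 (P? x))) ⟩
  (∑[ x ∈ xs ] 𝟙 (P? x))             ∎

total-X : ∀ {n} (G : Graph n) m → total n (X G) m ≡ (∑[ κ ∈ vectors (upTo m) n ] 𝟙 (proper? G κ))
total-X {n} G m = trans
  (total-∑x n (λ k → map toList (filter (proper? G) (vectors (upTo k) n))) m λ w∈ →
    let κ , _ , w≡κ = ∈ₚ.∈-map⁻ toList w∈ in
    ℕₚ.≤-reflexive (trans (cong length w≡κ) (Vecₚ.length-toList κ)))
  (ι-length-filter (proper? G) toList (vectors (upTo m) n))

fillings-size : ∀ {m} λs {T} → T ∈ fillings m λs → length (concat T) ≡ sum λs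
fillings-size [] (here refl) = refl
fillings-size {m} (r ∷ λs) T∈
  with ∈ₚ.∈-cartesianProductWith⁻ _∷_ (words (upTo m) r) (fillings m λs) T∈
... | row , T , row∈ , T∈′ , refl = trans (Listₚ.length-++ row)
  (cong₂ ℕ._+_ (∈-words⇒length row∈) (fillings-size λs T∈′))

tableaux : List ℕ → ℕ → ℚ
tableaux λs m = ∑[ T ∈ fillings m λs ] 𝟙 (semistandard? T)

total-s : ∀ {n} λs → sum λs ≡ n → ∀ m → total n (s λs) m ≡ tableaux λs m
total-s {n} λs size m = trans
  (total-∑x n (λ k → map concat (filter semistandard? (fillings k λs))) m λ w∈ →
    let T , T∈ , w≡T = ∈ₚ.∈-map⁻ concat w∈ in
    ℕₚ.≤-reflexive (trans (cong length w≡T) (trans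
      (fillings-size λs (proj₁ (∈ₚ.∈-filter⁻ semistandard? {xs = fillings m λs} T∈))) size)))
  (ι-length-filter semistandard? concat (fillings m λs))

-- Semistandard tableaux

-- Semistandardness is split into products of rational indicators, so that factors depending on one
-- row can be moved out of the sums over the others.
leading : ℕ → List ℕ → ℚ
leading x []      = 1ℚ
leading x (y ∷ _) = 𝟙 (x ℕₚ.≤? y)

sorted : List ℕ → ℚ
sorted []       = 1ℚ
sorted (x ∷ xs) = leading x xs * sorted xs

above : List ℕ → List ℕ → ℚ
above []       _        = 1ℚ
above (x ∷ xs) []       = 1ℚ
above (x ∷ xs) (y ∷ ys) = 𝟙 (x ℕₚ.<? y) * above xs ys

-- The indicator of the fillings that remain semistandard below the row u.

weight : List ℕ → Filling → ℚ
weight u []      = 1ℚ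
weight u (r ∷ T) = sorted r * (above u r * weight r T)

sorted-𝟙 : ∀ r → 𝟙 (Linked.linked? ℕₚ._≤?_ r) ≡ sorted r
sorted-𝟙 []           = refl
sorted-𝟙 (x ∷ [])     = refl
sorted-𝟙 (x ∷ y ∷ xs) = trans
  (𝟙-× (Linked.linked? ℕₚ._≤?_ (x ∷ y ∷ xs)) (x ℕₚ.≤? y) (Linked.linked? ℕₚ._≤?_ (y ∷ xs))
    (λ { (p ∷ ps) → p , ps }) _∷_)
  (cong (𝟙 (x ℕₚ.≤? y) *_) (sorted-𝟙 (y ∷ xs)))

above? : ∀ r r′ → Dec (r Above r′)
above? r r′ = All.all? (uncurry ℕₚ._<?_) (zip r r′)

above-𝟙 : ∀ r r′ → 𝟙 (above? r r′) ≡ above r r′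
above-𝟙 []       _        = refl
above-𝟙 (x ∷ xs) []       = refl
above-𝟙 (x ∷ xs) (y ∷ ys) = trans
  (𝟙-× (above? (x ∷ xs) (y ∷ ys)) (x ℕₚ.<? y) (above? xs ys) (λ { (p ∷ ps) → p , ps }) _∷_)
  (cong (𝟙 (x ℕₚ.<? y) *_) (above-𝟙 xs ys))

below? : ∀ u T → Dec (All (Linked ℕ._≤_) T × Linked _Above_ (u ∷ T))
below? u T = All.all? (Linked.linked? ℕₚ._≤?_) T ×-dec Linked.linked? above? (u ∷ T)

weight-𝟙 : ∀ u T → 𝟙 (below? u T) ≡ weight u T
weight-𝟙 u []      = refl
weight-𝟙 u (r ∷ T) = begin
  𝟙 (below? u (r ∷ T))
    ≡⟨ 𝟙-× (below? u (r ∷ T)) sorted? (above? u r ×-dec below? r T)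
         (λ { (s ∷ ss , a ∷ as) → s , a , ss , as }) (λ { s (a , ss , as) → s ∷ ss , a ∷ as }) ⟩
  𝟙 sorted? * 𝟙 (above? u r ×-dec below? r T)
    ≡⟨ cong₂ _*_ (sorted-𝟙 r) (𝟙-× (above? u r ×-dec below? r T) (above? u r) (below? r T) id _,_) ⟩
  sorted r * (𝟙 (above? u r) * 𝟙 (below? r T))
    ≡⟨ cong (sorted r *_) (cong₂ _*_ (above-𝟙 u r) (weight-𝟙 r T)) ⟩
  sorted r * (above u r * weight r T) ∎
  where sorted? = Linked.linked? ℕₚ._≤?_ r

-- Branching proceeds row by row and has to remember the row `u` directly above, which constrains
-- the first row of the remaining shape.
tableauxBelow : List ℕ → List ℕ → ℕ → ℚ
tableauxBelow u λs m = ∑[ T ∈ fillings m λs ] weight u T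

tableaux-below : ∀ λs m → tableaux λs m ≡ tableauxBelow [] λs m
tableaux-below λs m = ∑-cong (fillings m λs) λ T → trans
  (𝟙-cong (semistandard? T) (below? [] T)
    (λ { (ss , as) → ss , cons as }) (λ { (ss , as) → ss , Linked.tail as }))
  (weight-𝟙 [] T)
  where
  cons : ∀ {T} → Linked _Above_ T → Linked _Above_ ([] ∷ T)
  cons []       = [-]
  cons [-]      = [] ∷ [-]
  cons (a ∷ as) = [] ∷ a ∷ as

tableauxBelow-∷ : ∀ u ℓ λs m → tableauxBelow u (ℓ ∷ λs) m ≡
  (∑[ r ∈ words (upTo m) ℓ ] (sorted r * (above u r * tableauxBelow r λs m)))
tableauxBelow-∷ u ℓ λs m = begin
  tableauxBelow u (ℓ ∷ λs) m
    ≡⟨ ∑-× _∷_ (words (upTo m) ℓ) (fillings m λs) (weight u) ⟩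
  (∑[ r ∈ words (upTo m) ℓ ] ∑[ T ∈ fillings m λs ] (sorted r * (above u r * weight r T)))
    ≡⟨ ∑-cong (words (upTo m) ℓ) (λ r → trans
         (∑-*ˡ (sorted r) (fillings m λs) (λ T → above u r * weight r T))
         (cong (sorted r *_) (∑-*ˡ (above u r) (fillings m λs) (weight r)))) ⟩
  (∑[ r ∈ words (upTo m) ℓ ] (sorted r * (above u r * tableauxBelow r λs m))) ∎

∑-words-suc : ∀ {A : Set} (as : List A) n (f : List A → ℚ) →
              ∑ (words as (suc n)) f ≡ (∑[ a ∈ as ] ∑[ w ∈ words as n ] f (a ∷ w))
∑-words-suc as n f = begin
  ∑ (words as (suc n)) f                              ≡⟨ ∑-map toList (vectors as (suc n)) f ⟩
  ∑ (vectors as (suc n)) (f ∘ toList)                 ≡⟨ ∑-× Vec._∷_ as (vectors as n) (f ∘ toList) ⟩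
  (∑[ a ∈ as ] ∑[ κ ∈ vectors as n ] f (a ∷ toList κ))
    ≡⟨ ∑-cong as (λ a → sym (∑-map toList (vectors as n) (f ∘ (a ∷_)))) ⟩
  (∑[ a ∈ as ] ∑[ w ∈ words as n ] f (a ∷ w))         ∎

∑-words-0 : ∀ {A : Set} (as : List A) (f : List A → ℚ) → ∑ (words as 0) f ≡ f []
∑-words-0 as f = ℚₚ.+-identityʳ (f [])

leading-replicate : ∀ {x m} → x ℕ.≤ m → ∀ k → leading x (replicate k m) ≡ 1ℚ
leading-replicate x≤m zero    = refl
leading-replicate x≤m (suc k) = 𝟙-yes (_ ℕₚ.≤? _) x≤m

leading-++ : ∀ {x m} → x ℕ.≤ m → ∀ p k → leading x (p ++ replicate k m) ≡ leading x p
leading-++ x≤m []      k = leading-replicate x≤m k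
leading-++ x≤m (_ ∷ _) k = refl

-- A sorted row with entries ≤ m consists of entries < m followed by copies of m.

∑-sorted : ∀ m ℓ (g : List ℕ → ℚ) →
  (∑[ r ∈ words (upTo (suc m)) ℓ ] (sorted r * g r)) ≡
  (∑[ j ∈ upTo (suc ℓ) ] ∑[ p ∈ words (upTo m) j ] (sorted p * g (p ++ replicate (ℓ ℕ.∸ j) m)))
∑-sorted m zero    g = sym (ℚₚ.+-identityʳ (1ℚ * g [] + 0ℚ))
∑-sorted m (suc ℓ) g = begin
  (∑[ r ∈ words (upTo (suc m)) (suc ℓ) ] (sorted r * g r))
    ≡⟨ ∑-words-suc (upTo (suc m)) ℓ (λ r → sorted r * g r) ⟩
  (∑[ a ∈ upTo (suc m) ] ∑[ r ∈ words (upTo (suc m)) ℓ ] (leading a r * sorted r * g (a ∷ r)))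
    ≡⟨ ∑-cong (upTo (suc m)) (λ a → trans
         (∑-cong (words (upTo (suc m)) ℓ) (λ r →
           solve 3 (λ x y z → x :* y :* z := y :* (x :* z)) refl (leading a r) (sorted r) (g (a ∷ r))))
         (∑-sorted m ℓ (λ r → leading a r * g (a ∷ r)))) ⟩
  (∑[ a ∈ upTo (suc m) ] H a)
    ≡⟨ ∑-upTo-last m H ⟩
  ∑ (upTo m) H + H m
    -- A first letter below m lengthens `p` and gives the terms with j ≥ 1. A first letter m forces
    -- the whole row to consist of m, which is the term j = 0.
    ≡⟨ cong₂ _+_ small large ⟩
  (∑[ j ∈ upTo (suc ℓ) ] F (suc j)) + F 0
    ≡⟨ ℚₚ.+-comm (∑[ j ∈ upTo (suc ℓ) ] F (suc j)) (F 0) ⟩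
  F 0 + (∑[ j ∈ upTo (suc ℓ) ] F (suc j))
    ≡⟨ sym (∑-upTo-first (suc ℓ) F) ⟩
  (∑[ j ∈ upTo (suc (suc ℓ)) ] F j) ∎
  where
  F : ℕ → ℚ
  F j = ∑[ p ∈ words (upTo m) j ] (sorted p * g (p ++ replicate (suc ℓ ℕ.∸ j) m))
  tail : ℕ → ℕ → List ℕ → ℚ
  tail a j p = sorted p * (leading a (p ++ replicate (ℓ ℕ.∸ j) m) * g (a ∷ p ++ replicate (ℓ ℕ.∸ j) m))
  H : ℕ → ℚ
  H a = ∑[ j ∈ upTo (suc ℓ) ] ∑[ p ∈ words (upTo m) j ] tail a j p
  small : ∑ (upTo m) H ≡ (∑[ j ∈ upTo (suc ℓ) ] F (suc j))
  small = begin
    ∑ (upTo m) H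
      ≡⟨ ∑-swap (upTo m) (upTo (suc ℓ)) (λ a j → ∑[ p ∈ words (upTo m) j ] tail a j p) ⟩
    (∑[ j ∈ upTo (suc ℓ) ] ∑[ a ∈ upTo m ] ∑[ p ∈ words (upTo m) j ] tail a j p)
      ≡⟨ ∑-cong (upTo (suc ℓ)) (λ j → trans
           (∑-cong-∈ (upTo m) (λ {a} a∈ → ∑-cong (words (upTo m) j) (λ p → trans
             (cong (λ x → sorted p * (x * g (a ∷ p ++ replicate (ℓ ℕ.∸ j) m)))
               (leading-++ (ℕₚ.<⇒≤ (∈ₚ.∈-upTo⁻ a∈)) p (ℓ ℕ.∸ j)))
             (solve 3 (λ x y z → y :* (x :* z) := x :* y :* z) refl
               (leading a p) (sorted p) (g (a ∷ p ++ replicate (ℓ ℕ.∸ j) m))))))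
           (sym (∑-words-suc (upTo m) j (λ p → sorted p * g (p ++ replicate (ℓ ℕ.∸ j) m))))) ⟩
    (∑[ j ∈ upTo (suc ℓ) ] F (suc j)) ∎
  blocked : ∀ j {p} → p ∈ words (upTo m) (suc j) → tail m (suc j) p ≡ 0ℚ
  blocked j {[]}    p∈ = contradiction (∈-words⇒length {as = upTo m} p∈) λ ()
  blocked j {y ∷ p} p∈ with ∈-words⇒All∈ p∈
  ... | y∈ ∷ _ = trans
    (cong (λ x → sorted (y ∷ p) * (x * rest)) (𝟙-no (m ℕₚ.≤? y) (ℕₚ.<⇒≱ (∈ₚ.∈-upTo⁻ y∈))))
    (solve 2 (λ x y → x :* (con 0ℚ :* y) := con 0ℚ) refl (sorted (y ∷ p)) rest)
    where rest = g (m ∷ (y ∷ p) ++ replicate (ℓ ℕ.∸ suc j) m)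
  large : H m ≡ F 0
  large = begin
    H m
      ≡⟨ ∑-upTo-first ℓ (λ j → ∑[ p ∈ words (upTo m) j ] tail m j p) ⟩
    (∑[ p ∈ words (upTo m) 0 ] tail m 0 p) + (∑[ j ∈ upTo ℓ ] ∑[ p ∈ words (upTo m) (suc j) ] tail m (suc j) p)
      ≡⟨ cong₂ _+_ (∑-words-0 (upTo m) (tail m 0))
           (∑-vanish (upTo ℓ) (λ {j} _ → ∑-vanish (words (upTo m) (suc j)) (blocked j))) ⟩
    1ℚ * (leading m (replicate ℓ m) * g (replicate (suc ℓ) m)) + 0ℚ
      ≡⟨ cong (λ x → 1ℚ * (x * g (replicate (suc ℓ) m)) + 0ℚ) (leading-replicate (ℕₚ.≤-refl {m}) ℓ) ⟩
    1ℚ * (1ℚ * g (replicate (suc ℓ) m)) + 0ℚ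
      ≡⟨ cong (λ x → 1ℚ * x + 0ℚ) (ℚₚ.*-identityˡ (g (replicate (suc ℓ) m))) ⟩
    F 0 ∎

above-[] : ∀ r → above r [] ≡ 1ℚ
above-[] []      = refl
above-[] (_ ∷ _) = refl

-- No entry ≤ m can stand strictly below an m, so the lower row has to fit under `p`; there its own
-- copies of m satisfy the strict inequality. The length hypothesis excludes lower entries sticking
-- out beyond the upper row, which the truncating comparison would ignore.
above-++ : ∀ {m p p′} → All (ℕ._< m) p → All (ℕ._< m) p′ → ∀ a b →
  length p′ ℕ.+ b ℕ.≤ length p ℕ.+ a →
  above (p ++ replicate a m) (p′ ++ replicate b m) ≡
    𝟙 (length p′ ℕ.+ b ℕₚ.≤? length p) * above p p′
above-++ [] [] zero    zero    _ = refl
above-++ [] [] (suc a) zero    _ = refl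
above-++ {m} [] [] (suc a) (suc b) _ = trans
  (cong (_* above (replicate a m) (replicate b m)) (𝟙-no (m ℕₚ.<? m) (ℕₚ.<-irrefl refl)))
  (ℚₚ.*-zeroˡ (above (replicate a m) (replicate b m)))
above-++ {m} [] (_∷_ {y} {ys} y<m _) (suc a) b _ = trans
  (cong (_* above (replicate a m) (ys ++ replicate b m)) (𝟙-no (m ℕₚ.<? y) (ℕₚ.<-asym y<m)))
  (ℚₚ.*-zeroˡ (above (replicate a m) (ys ++ replicate b m)))
above-++ (_ ∷ _) [] a zero _ = refl
above-++ {m} (_∷_ {x} {xs} x<m xs<m) [] a (suc b) (s≤s b≤) = begin
  𝟙 (x ℕₚ.<? m) * above (xs ++ replicate a m) (replicate b m)
    ≡⟨ cong₂ _*_ (𝟙-yes (x ℕₚ.<? m) x<m) (above-++ xs<m [] a b b≤) ⟩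
  1ℚ * (𝟙 (b ℕₚ.≤? length xs) * above xs [])
    ≡⟨ ℚₚ.*-identityˡ (𝟙 (b ℕₚ.≤? length xs) * above xs []) ⟩
  𝟙 (b ℕₚ.≤? length xs) * above xs []
    ≡⟨ cong₂ _*_ (𝟙-cong (b ℕₚ.≤? length xs) (suc b ℕₚ.≤? suc (length xs)) s≤s ℕ.s≤s⁻¹) (above-[] xs) ⟩
  𝟙 (suc b ℕₚ.≤? suc (length xs)) * 1ℚ ∎
above-++ {m} {x ∷ xs} {y ∷ ys} (_ ∷ xs<m) (_ ∷ ys<m) a b (s≤s le) = begin
  𝟙 (x ℕₚ.<? y) * above (xs ++ replicate a m) (ys ++ replicate b m)
    ≡⟨ cong (𝟙 (x ℕₚ.<? y) *_) (trans (above-++ xs<m ys<m a b le)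
         (cong (_* above xs ys) (𝟙-cong (length ys ℕ.+ b ℕₚ.≤? length xs)
           (suc (length ys ℕ.+ b) ℕₚ.≤? suc (length xs)) s≤s ℕ.s≤s⁻¹))) ⟩
  𝟙 (x ℕₚ.<? y) * (fits * above xs ys)
    ≡⟨ solve 3 (λ i j k → i :* (j :* k) := j :* (i :* k)) refl (𝟙 (x ℕₚ.<? y)) fits (above xs ys) ⟩
  fits * (𝟙 (x ℕₚ.<? y) * above xs ys) ∎
  where fits = 𝟙 (suc (length ys ℕ.+ b) ℕₚ.≤? suc (length xs))

-- Horizontal strips and branching

first : List ℕ → ℕ
first []      = 0
first (ℓ ∷ _) = ℓ

Decreasing : List ℕ → Set
Decreasing []       = ⊤
Decreasing (ℓ ∷ λs) = first λs ℕ.≤ ℓ × Decreasing λs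

Linked⇒Decreasing : ∀ {λs} → Linked ℕ._≥_ λs → Decreasing λs
Linked⇒Decreasing []       = tt
Linked⇒Decreasing [-]      = z≤n , tt
Linked⇒Decreasing (p ∷ ps) = p , Linked⇒Decreasing ps

-- The shapes μ such that λs / μ is a horizontal strip; parts of μ may be 0.

strips : List ℕ → List (List ℕ)
strips []       = [ [] ]
strips (ℓ ∷ λs) =
  cartesianProductWith _∷_ (filter (first λs ℕₚ.≤?_) (upTo (suc ℓ))) (strips λs)

∑-strips-∷ : ∀ ℓ λs (f : List ℕ → ℚ) → ∑ (strips (ℓ ∷ λs)) f ≡
  (∑[ j ∈ upTo (suc ℓ) ] (𝟙 (first λs ℕₚ.≤? j) * (∑[ μ ∈ strips λs ] f (j ∷ μ))))
∑-strips-∷ ℓ λs f = trans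
  (∑-× _∷_ (filter (first λs ℕₚ.≤?_) (upTo (suc ℓ))) (strips λs) f)
  (∑-filter (first λs ℕₚ.≤?_) (upTo (suc ℓ)) (λ j → ∑[ μ ∈ strips λs ] f (j ∷ μ)))

-- The branching rule: deleting the entries m from a semistandard tableau
-- with entries ≤ m removes a horizontal strip.

branch-below : ∀ m λs → Decreasing λs → ∀ {p} a → All (ℕ._< m) p → first λs ℕ.≤ length p ℕ.+ a →
  tableauxBelow (p ++ replicate a m) λs (suc m) ≡
    𝟙 (first λs ℕₚ.≤? length p) * (∑[ μ ∈ strips λs ] tableauxBelow p μ m)

-- The induction step, with the influence of the row above abstracted into a constant `c` and a
-- shortened row `u′`. Below another row, `c` is the indicator of the strip condition between
-- consecutive rows; at the top of the diagram it is 1 and both rows are empty.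
branch-row : ∀ m ℓ λs → Decreasing (ℓ ∷ λs) → ∀ u u′ c →
  (∀ {p} → All (ℕ._< m) p → length p ℕ.≤ ℓ →
    above u (p ++ replicate (ℓ ℕ.∸ length p) m) ≡ c * above u′ p) →
  tableauxBelow u (ℓ ∷ λs) (suc m) ≡ c * (∑[ μ ∈ strips (ℓ ∷ λs) ] tableauxBelow u′ μ m)

branch-below m []       _  a _ _ = refl
branch-below m (ℓ ∷ λs) dec {p} a p<m le = branch-row m ℓ λs dec (p ++ replicate a m) p
  (𝟙 (ℓ ℕₚ.≤? length p))
  λ {p′} p′<m ≤ℓ → subst
    (λ k → above (p ++ replicate a m) (p′ ++ replicate (ℓ ℕ.∸ length p′) m) ≡ 𝟙 (k ℕₚ.≤? length p) * above p p′)
    (ℕₚ.m+[n∸m]≡n ≤ℓ)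
    (above-++ p<m p′<m a (ℓ ℕ.∸ length p′)
      (ℕₚ.≤-trans (ℕₚ.≤-reflexive (ℕₚ.m+[n∸m]≡n ≤ℓ)) le))

branch-row m ℓ λs (first≤ℓ , dec) u u′ c above-u = begin
  tableauxBelow u (ℓ ∷ λs) (suc m)
    ≡⟨ tableauxBelow-∷ u ℓ λs (suc m) ⟩
  (∑[ r ∈ words (upTo (suc m)) ℓ ] (sorted r * g r))
    ≡⟨ ∑-sorted m ℓ g ⟩
  (∑[ j ∈ upTo (suc ℓ) ] ∑[ p ∈ words (upTo m) j ] (sorted p * g (p ++ replicate (ℓ ℕ.∸ j) m)))
    ≡⟨ ∑-cong-∈ (upTo (suc ℓ)) (λ j∈ → column _ (ℕ.s≤s⁻¹ (∈ₚ.∈-upTo⁻ j∈))) ⟩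
  (∑[ j ∈ upTo (suc ℓ) ] (c * (𝟙 (first λs ℕₚ.≤? j) * S j)))
    ≡⟨ ∑-*ˡ c (upTo (suc ℓ)) (λ j → 𝟙 (first λs ℕₚ.≤? j) * S j) ⟩
  c * (∑[ j ∈ upTo (suc ℓ) ] (𝟙 (first λs ℕₚ.≤? j) * S j))
    ≡⟨ cong (c *_) (sym (∑-strips-∷ ℓ λs (λ μ → tableauxBelow u′ μ m))) ⟩
  c * (∑[ μ ∈ strips (ℓ ∷ λs) ] tableauxBelow u′ μ m) ∎
  where
  g : List ℕ → ℚ
  g r = above u r * tableauxBelow r λs (suc m)
  S : ℕ → ℚ
  S j = ∑[ μ ∈ strips λs ] tableauxBelow u′ (j ∷ μ) m
  R : List ℕ → ℚ
  R p = ∑[ μ ∈ strips λs ] tableauxBelow p μ m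
  entry : ∀ j → j ℕ.≤ ℓ → ∀ {p} → p ∈ words (upTo m) j →
    sorted p * g (p ++ replicate (ℓ ℕ.∸ j) m) ≡
      c * 𝟙 (first λs ℕₚ.≤? j) * (sorted p * (above u′ p * R p))
  entry j j≤ℓ {p} p∈ with ∈-words⇒length p∈
  ... | refl = trans
    (cong (sorted p *_) (cong₂ _*_ (above-u p<m j≤ℓ)
      (branch-below m λs dec (ℓ ℕ.∸ j) p<m
        (ℕₚ.≤-trans first≤ℓ (ℕₚ.≤-reflexive (sym (ℕₚ.m+[n∸m]≡n j≤ℓ)))))))
    (solve 5 (λ s c a i r → s :* (c :* a :* (i :* r)) := c :* i :* (s :* (a :* r))) refl
      (sorted p) c (above u′ p) (𝟙 (first λs ℕₚ.≤? j)) (R p))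
    where p<m = All.map ∈ₚ.∈-upTo⁻ (∈-words⇒All∈ p∈)
  ∑R : ∀ j → (∑[ p ∈ words (upTo m) j ] (sorted p * (above u′ p * R p))) ≡ S j
  ∑R j = begin
    (∑[ p ∈ words (upTo m) j ] (sorted p * (above u′ p * R p)))
      ≡⟨ ∑-cong (words (upTo m) j) (λ p → trans
           (cong (sorted p *_) (sym (∑-*ˡ (above u′ p) (strips λs) (λ μ → tableauxBelow p μ m))))
           (sym (∑-*ˡ (sorted p) (strips λs) (λ μ → above u′ p * tableauxBelow p μ m)))) ⟩
    (∑[ p ∈ words (upTo m) j ] ∑[ μ ∈ strips λs ] (sorted p * (above u′ p * tableauxBelow p μ m)))
      ≡⟨ ∑-swap (words (upTo m) j) (strips λs) (λ p μ → sorted p * (above u′ p * tableauxBelow p μ m)) ⟩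
    (∑[ μ ∈ strips λs ] ∑[ p ∈ words (upTo m) j ] (sorted p * (above u′ p * tableauxBelow p μ m)))
      ≡⟨ ∑-cong (strips λs) (λ μ → sym (tableauxBelow-∷ u′ j μ m)) ⟩
    S j ∎
  column : ∀ j → j ℕ.≤ ℓ →
    (∑[ p ∈ words (upTo m) j ] (sorted p * g (p ++ replicate (ℓ ℕ.∸ j) m))) ≡
      c * (𝟙 (first λs ℕₚ.≤? j) * S j)
  column j j≤ℓ = begin
    (∑[ p ∈ words (upTo m) j ] (sorted p * g (p ++ replicate (ℓ ℕ.∸ j) m)))
      ≡⟨ ∑-cong-∈ (words (upTo m) j) (entry j j≤ℓ) ⟩
    (∑[ p ∈ words (upTo m) j ] (c * i * (sorted p * (above u′ p * R p))))
      ≡⟨ ∑-*ˡ (c * i) (words (upTo m) j) (λ p → sorted p * (above u′ p * R p)) ⟩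
    c * i * (∑[ p ∈ words (upTo m) j ] (sorted p * (above u′ p * R p)))
      ≡⟨ cong (c * i *_) (∑R j) ⟩
    c * i * S j
      ≡⟨ ℚₚ.*-assoc c i (S j) ⟩
    c * (i * S j) ∎
    where i = 𝟙 (first λs ℕₚ.≤? j)

branch : ∀ λs → Decreasing λs → ∀ m → tableaux λs (suc m) ≡ (∑[ μ ∈ strips λs ] tableaux μ m)
branch []       _   m = refl
branch (ℓ ∷ λs) dec m = begin
  tableaux (ℓ ∷ λs) (suc m)
    ≡⟨ tableaux-below (ℓ ∷ λs) (suc m) ⟩
  tableauxBelow [] (ℓ ∷ λs) (suc m)
    ≡⟨ branch-row m ℓ λs dec [] [] 1ℚ (λ _ _ → refl) ⟩
  1ℚ * (∑[ μ ∈ strips (ℓ ∷ λs) ] tableauxBelow [] μ m)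
    ≡⟨ ℚₚ.*-identityˡ (∑[ μ ∈ strips (ℓ ∷ λs) ] tableauxBelow [] μ m) ⟩
  (∑[ μ ∈ strips (ℓ ∷ λs) ] tableauxBelow [] μ m)
    ≡⟨ ∑-cong (strips (ℓ ∷ λs)) (λ μ → sym (tableaux-below μ m)) ⟩
  (∑[ μ ∈ strips (ℓ ∷ λs) ] tableaux μ m) ∎

-- For a decreasing shape, the strips other than the shape itself: either the first part shrinks, or
-- it is kept and a later part shrinks. Once the unchanged shape is cancelled, branching expresses
-- `Δ (tableaux λs)` through strictly smaller shapes.
smallerStrips : List ℕ → List (List ℕ)
smallerStrips []       = []
smallerStrips (ℓ ∷ λs) =
  cartesianProductWith _∷_ (filter (first λs ℕₚ.≤?_) (upTo ℓ)) (strips λs) ++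
  map (ℓ ∷_) (smallerStrips λs)

∑-strips : ∀ λs → Decreasing λs → (f : List ℕ → ℚ) →
           ∑ (strips λs) f ≡ ∑ (smallerStrips λs) f + f λs
∑-strips []       _ f = ℚₚ.+-comm (f []) 0ℚ
∑-strips (ℓ ∷ λs) (first≤ℓ , dec) f = begin
  ∑ (strips (ℓ ∷ λs)) f
    ≡⟨ ∑-strips-∷ ℓ λs f ⟩
  (∑[ j ∈ upTo (suc ℓ) ] (𝟙 (first λs ℕₚ.≤? j) * S j))
    ≡⟨ ∑-upTo-last ℓ (λ j → 𝟙 (first λs ℕₚ.≤? j) * S j) ⟩
  L + 𝟙 (first λs ℕₚ.≤? ℓ) * S ℓ
    ≡⟨ cong₂ (λ i s → L + i * s) (𝟙-yes (first λs ℕₚ.≤? ℓ) first≤ℓ) (∑-strips λs dec (f ∘ (ℓ ∷_))) ⟩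
  L + 1ℚ * (M + f (ℓ ∷ λs))
    ≡⟨ solve 3 (λ l m x → l :+ con 1ℚ :* (m :+ x) := l :+ m :+ x) refl L M (f (ℓ ∷ λs)) ⟩
  L + M + f (ℓ ∷ λs)
    ≡⟨ cong (_+ f (ℓ ∷ λs)) (sym (trans
         (∑-++ (cartesianProductWith _∷_ shorter (strips λs)) (map (ℓ ∷_) (smallerStrips λs)) f)
         (cong₂ _+_
           (trans (∑-× _∷_ shorter (strips λs) f) (∑-filter (first λs ℕₚ.≤?_) (upTo ℓ) S))
           (∑-map (ℓ ∷_) (smallerStrips λs) f)))) ⟩
  ∑ (smallerStrips (ℓ ∷ λs)) f + f (ℓ ∷ λs) ∎
  where
  shorter = filter (first λs ℕₚ.≤?_) (upTo ℓ)
  S : ℕ → ℚ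
  S j = ∑[ μ ∈ strips λs ] f (j ∷ μ)
  L = ∑[ j ∈ upTo ℓ ] (𝟙 (first λs ℕₚ.≤? j) * S j)
  M = ∑[ μ ∈ smallerStrips λs ] f (ℓ ∷ μ)

-- The middle bound is what makes `j ∷ μ` decreasing: j is at least the first part of `λs`, hence at
-- least that of `μ`.
strips-≤ : ∀ λs {μ} → μ ∈ strips λs →
           Decreasing μ × first μ ℕ.≤ first λs × sum μ ℕ.≤ sum λs
strips-≤ [] (here refl) = tt , z≤n , z≤n
strips-≤ (ℓ ∷ λs) μ∈
  with ∈ₚ.∈-cartesianProductWith⁻ _∷_ (filter (first λs ℕₚ.≤?_) (upTo (suc ℓ))) (strips λs) μ∈
... | j , μ , j∈ , μ∈′ , refl
  with ∈ₚ.∈-filter⁻ (first λs ℕₚ.≤?_) {xs = upTo (suc ℓ)} j∈ | strips-≤ λs μ∈′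
... | j∈′ , first≤j | dec , first≤ , sum≤ =
  (ℕₚ.≤-trans first≤ first≤j , dec) , j≤ℓ , ℕₚ.+-mono-≤ j≤ℓ sum≤
  where j≤ℓ = ℕ.s≤s⁻¹ (∈ₚ.∈-upTo⁻ j∈′)

smallerStrips-< : ∀ λs {μ} → Decreasing λs → μ ∈ smallerStrips λs →
                  Decreasing μ × first μ ℕ.≤ first λs × sum μ ℕ.< sum λs
smallerStrips-< (ℓ ∷ λs) (first≤ℓ , dec) μ∈
  with ∈ₚ.∈-++⁻ (cartesianProductWith _∷_ (filter (first λs ℕₚ.≤?_) (upTo ℓ)) (strips λs)) μ∈
... | inj₁ μ∈₁
  with ∈ₚ.∈-cartesianProductWith⁻ _∷_ (filter (first λs ℕₚ.≤?_) (upTo ℓ)) (strips λs) μ∈₁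
...   | j , μ , j∈ , μ∈′ , refl
  with ∈ₚ.∈-filter⁻ (first λs ℕₚ.≤?_) {xs = upTo ℓ} j∈ | strips-≤ λs μ∈′
...     | j∈′ , first≤j | dec′ , first≤ , sum≤ =
  (ℕₚ.≤-trans first≤ first≤j , dec′) , ℕₚ.<⇒≤ j<ℓ , ℕₚ.+-mono-<-≤ j<ℓ sum≤
  where j<ℓ = ∈ₚ.∈-upTo⁻ j∈′
smallerStrips-< (ℓ ∷ λs) (first≤ℓ , dec) μ∈ | inj₂ μ∈₂ with ∈ₚ.∈-map⁻ (ℓ ∷_) μ∈₂
... | μ , μ∈′ , refl with smallerStrips-< λs dec μ∈′
...   | dec′ , first≤ , sum< = (ℕₚ.≤-trans first≤ first≤ℓ , dec′) , ℕₚ.≤-refl , ℕₚ.+-monoʳ-< ℓ sum<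

-- ε λ is the value at −1 of the number of semistandard tableaux of shape λ
-- with entries < m, as a polynomial in m.

part-ε : ℕ → ℚ
part-ε 0             = 1ℚ
part-ε 1             = - 1ℚ
part-ε (suc (suc _)) = 0ℚ

ε : List ℕ → ℚ
ε []       = 1ℚ
ε (ℓ ∷ λs) = part-ε ℓ * ε λs

-- The tableau count at m = 0: with no letters available, only a shape without boxes has a filling.
part-empty : ℕ → ℚ
part-empty zero    = 1ℚ
part-empty (suc _) = 0ℚ

empty : List ℕ → ℚ
empty []       = 1ℚ
empty (ℓ ∷ λs) = part-empty ℓ * empty λs

∑-part-ε : ∀ ℓ → ∑ (upTo (suc ℓ)) part-ε ≡ part-empty ℓ
∑-part-ε zero    = refl
∑-part-ε (suc k) = begin
  ∑ (upTo (suc (suc k))) part-ε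
    ≡⟨ ∑-upTo-first (suc k) part-ε ⟩
  1ℚ + ∑ (upTo (suc k)) (part-ε ∘ suc)
    ≡⟨ cong (1ℚ +_) (∑-upTo-first k (part-ε ∘ suc)) ⟩
  1ℚ + (- 1ℚ + ∑ (upTo k) (λ _ → 0ℚ))
    ≡⟨ cong (λ z → 1ℚ + (- 1ℚ + z)) (∑-zero (upTo k)) ⟩
  0ℚ ∎

-- This is the branching rule at m = -1, with the count for 0 letters on the right. The bound
-- `first λs ≤ j` couples the first part to the others, but either `first λs` is 0 and the bound
-- always holds, or both sides contain the factor `empty λs`, which is 0. What remains is the sum 1
-- - 1 + 0 + ⋯ over j ≤ ℓ.
∑-strips-ε : ∀ λs → ∑ (strips λs) ε ≡ empty λs
∑-strips-ε []       = refl
∑-strips-ε (ℓ ∷ λs) = begin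
  ∑ (strips (ℓ ∷ λs)) ε
    ≡⟨ ∑-strips-∷ ℓ λs ε ⟩
  (∑[ j ∈ upTo (suc ℓ) ] (𝟙 (first λs ℕₚ.≤? j) * (∑[ μ ∈ strips λs ] (part-ε j * ε μ))))
    ≡⟨ ∑-cong (upTo (suc ℓ)) (λ j → trans
         (cong (𝟙 (first λs ℕₚ.≤? j) *_)
           (trans (∑-*ˡ (part-ε j) (strips λs) ε) (cong (part-ε j *_) (∑-strips-ε λs))))
         (sym (ℚₚ.*-assoc (𝟙 (first λs ℕₚ.≤? j)) (part-ε j) (empty λs)))) ⟩
  (∑[ j ∈ upTo (suc ℓ) ] (𝟙 (first λs ℕₚ.≤? j) * part-ε j * empty λs))
    ≡⟨ ∑-*ʳ (empty λs) (upTo (suc ℓ)) (λ j → 𝟙 (first λs ℕₚ.≤? j) * part-ε j) ⟩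
  (∑[ j ∈ upTo (suc ℓ) ] (𝟙 (first λs ℕₚ.≤? j) * part-ε j)) * empty λs
    ≡⟨ unconstrained λs ⟩
  part-empty ℓ * empty λs ∎
  where
  unrestricted : ∀ {λs} → first λs ≡ 0 →
    (∑[ j ∈ upTo (suc ℓ) ] (𝟙 (first λs ℕₚ.≤? j) * part-ε j)) * empty λs ≡ part-empty ℓ * empty λs
  unrestricted {λs} eq = cong (_* empty λs) (trans
    (∑-cong (upTo (suc ℓ)) (λ j → trans
      (cong (_* part-ε j) (𝟙-yes (first λs ℕₚ.≤? j) (subst (ℕ._≤ j) (sym eq) z≤n)))
      (ℚₚ.*-identityˡ (part-ε j))))
    (∑-part-ε ℓ))
  unconstrained : ∀ λs →
    (∑[ j ∈ upTo (suc ℓ) ] (𝟙 (first λs ℕₚ.≤? j) * part-ε j)) * empty λs ≡ part-empty ℓ * empty λs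
  unconstrained []             = unrestricted {[]} refl
  unconstrained (zero ∷ λs)    = unrestricted {zero ∷ λs} refl
  unconstrained (suc k ∷ λs)   = solve 3
    (λ x y z → x :* (con 0ℚ :* z) := y :* (con 0ℚ :* z)) refl
    (∑[ j ∈ upTo (suc ℓ) ] (𝟙 (suc k ℕₚ.≤? j) * part-ε j)) (part-empty ℓ) (empty λs)

tableauxBelow-0 : ∀ u λs → tableauxBelow u λs 0 ≡ empty λs
tableauxBelow-0 u []           = refl
tableauxBelow-0 u (suc ℓ ∷ λs) = trans (tableauxBelow-∷ u (suc ℓ) λs 0) (sym (ℚₚ.*-zeroˡ (empty λs)))
tableauxBelow-0 u (zero ∷ λs)  = begin
  tableauxBelow u (zero ∷ λs) 0
    ≡⟨ tableauxBelow-∷ u zero λs 0 ⟩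
  1ℚ * (above u [] * tableauxBelow [] λs 0) + 0ℚ
    ≡⟨ ℚₚ.+-identityʳ (1ℚ * (above u [] * tableauxBelow [] λs 0)) ⟩
  1ℚ * (above u [] * tableauxBelow [] λs 0)
    ≡⟨ cong (1ℚ *_) (cong₂ _*_ (above-[] u) (tableauxBelow-0 [] λs)) ⟩
  1ℚ * (1ℚ * empty λs)
    ≡⟨ cong (1ℚ *_) (ℚₚ.*-identityˡ (empty λs)) ⟩
  1ℚ * empty λs ∎

-- Induction on the degree bound: `Δ (tableaux λs)` is the sum of the counts of the smaller strips,
-- and its value at -1 has to be `tableaux λs 0 - ε λs`, which `∑-strips-ε` confirms.
tableaux-Ext : ∀ d λs → Decreasing λs → sum λs ℕ.< d → Ext d (tableaux λs) (ε λs)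
tableaux-Ext (suc d) λs dec (s≤s sum≤d) = Ext-cong d
  (λ m → trans (difference (λ μ → tableaux μ m)) (cong (_- tableaux λs m) (sym (branch λs dec m))))
  (trans (difference ε) (cong (_- ε λs) (trans (∑-strips-ε λs)
    (trans (sym (tableauxBelow-0 [] λs)) (sym (tableaux-below λs 0))))))
  (Ext-∑ d (smallerStrips λs) {λ μ m → tableaux μ m} {ε} λ {μ} μ∈ →
    let dec′ , _ , sum< = smallerStrips-< λs dec μ∈ in
    tableaux-Ext d μ dec′ (ℕₚ.<-≤-trans sum< sum≤d))
  where
  difference : ∀ f → ∑ (smallerStrips λs) f ≡ ∑ (strips λs) f - f λs
  difference f = begin
    ∑ (smallerStrips λs) f
      ≡⟨ solve 2 (λ s x → s := s :+ x :- x) refl (∑ (smallerStrips λs) f) (f λs) ⟩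
    ∑ (smallerStrips λs) f + f λs - f λs
      ≡⟨ cong (_- f λs) (sym (∑-strips λs dec f)) ⟩
    ∑ (strips λs) f - f λs ∎

-- Acyclic orientations by deletion and contraction

infixr 5 _▹_

-- us ▹ g adds to g a new vertex 0, adjacent to the vertices us of g.

data Layered : ℕ → Set where
  ∅   : Layered 0
  _▹_ : ∀ {n} → List (Fin n) → Layered n → Layered (suc n)

unequal : ℕ → ℕ → ℚ
unequal a b = 𝟙 (¬? (a ℕₚ.≟ b))

avoids : ∀ {n} → ℕ → List (Fin n) → Vec ℕ n → ℚ
avoids a []       κ = 1ℚ
avoids a (u ∷ us) κ = unequal a (lookup κ u) * avoids a us κ

proper : ∀ {n} → Layered n → Vec ℕ n → ℚ
proper ∅        []      = 1ℚ
proper (us ▹ g) (a ∷ κ) = avoids a us κ * proper g κ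

-- Serves contraction: the newest vertex is merged into `u` by joining `u` to the other neighbours.
-- An edge is stored at its newer endpoint, and an edge already present becomes a repeated entry.
addEdge : ∀ {n} → Fin n → Fin n → Layered n → Layered n
addEdge zero    zero    g        = g
addEdge zero    (suc v) (us ▹ g) = (v ∷ us) ▹ g
addEdge (suc u) zero    (us ▹ g) = (u ∷ us) ▹ g
addEdge (suc u) (suc v) (us ▹ g) = us ▹ addEdge u v g

addEdges : ∀ {n} → Fin n → List (Fin n) → Layered n → Layered n
addEdges u vs g = foldr (addEdge u) g vs

unequal-sym : ∀ a b → unequal a b ≡ unequal b a
unequal-sym a b = 𝟙-cong (¬? (a ℕₚ.≟ b)) (¬? (b ℕₚ.≟ a)) (_∘ sym) (_∘ sym)

proper-addEdge : ∀ {n} {u v : Fin n} → u ≢ v → ∀ g κ →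
  proper (addEdge u v g) κ ≡ unequal (lookup κ u) (lookup κ v) * proper g κ
proper-addEdge {u = zero}  {zero}  u≢v g κ = contradiction refl u≢v
proper-addEdge {u = zero}  {suc v} u≢v (us ▹ g) (a ∷ κ) =
  ℚₚ.*-assoc (unequal a (lookup κ v)) (avoids a us κ) (proper g κ)
proper-addEdge {u = suc u} {zero}  u≢v (us ▹ g) (a ∷ κ) = trans
  (ℚₚ.*-assoc (unequal a (lookup κ u)) (avoids a us κ) (proper g κ))
  (cong (_* (avoids a us κ * proper g κ)) (unequal-sym a (lookup κ u)))
proper-addEdge {u = suc u} {suc v} u≢v (us ▹ g) (a ∷ κ) = trans
  (cong (avoids a us κ *_) (proper-addEdge (u≢v ∘ cong suc) g κ))
  (solve 3 (λ x y z → x :* (y :* z) := y :* (x :* z)) refl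
    (avoids a us κ) (unequal (lookup κ u) (lookup κ v)) (proper g κ))

proper-addEdges : ∀ {n} {u : Fin n} {vs} → u ∉ vs → ∀ g κ →
  proper (addEdges u vs g) κ ≡ avoids (lookup κ u) vs κ * proper g κ
proper-addEdges {vs = []} _ g κ = sym (ℚₚ.*-identityˡ (proper g κ))
proper-addEdges {u = u} {v ∷ vs} u∉ g κ = begin
  proper (addEdge u v (addEdges u vs g)) κ
    ≡⟨ proper-addEdge (u∉ ∘ here) (addEdges u vs g) κ ⟩
  unequal x y * proper (addEdges u vs g) κ
    ≡⟨ cong (unequal x y *_) (proper-addEdges (u∉ ∘ there) g κ) ⟩
  unequal x y * (avoids x vs κ * proper g κ)
    ≡⟨ sym (ℚₚ.*-assoc (unequal x y) (avoids x vs κ) (proper g κ)) ⟩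
  unequal x y * avoids x vs κ * proper g κ ∎
  where
  x = lookup κ u
  y = lookup κ v

colorings : ∀ {n} → Layered n → ℕ → ℚ
colorings {n} g m = ∑[ κ ∈ vectors (upTo m) n ] proper g κ

colorings-▹ : ∀ {n} us (g : Layered n) m → colorings (us ▹ g) m ≡
  (∑[ κ ∈ vectors (upTo m) n ] ∑[ a ∈ upTo m ] (avoids a us κ * proper g κ))
colorings-▹ {n} us g m = trans
  (∑-× Vec._∷_ (upTo m) (vectors (upTo m) n) (proper (us ▹ g)))
  (∑-swap (upTo m) (vectors (upTo m) n) (λ a κ → avoids a us κ * proper g κ))

colorings-isolated : ∀ {n} (g : Layered n) m → colorings ([] ▹ g) m ≡ ι m * colorings g m
colorings-isolated {n} g m = begin
  colorings ([] ▹ g) m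
    ≡⟨ ∑-× Vec._∷_ (upTo m) (vectors (upTo m) n) (proper ([] ▹ g)) ⟩
  (∑[ a ∈ upTo m ] ∑[ κ ∈ vectors (upTo m) n ] (1ℚ * proper g κ))
    ≡⟨ ∑-cong (upTo m) (λ _ → ∑-*ˡ 1ℚ (vectors (upTo m) n) (proper g)) ⟩
  (∑[ a ∈ upTo m ] (1ℚ * colorings g m))
    ≡⟨ ∑-*ʳ (colorings g m) (upTo m) (λ _ → 1ℚ) ⟩
  (∑[ a ∈ upTo m ] 1ℚ) * colorings g m
    ≡⟨ cong (_* colorings g m) (trans (∑-1 (upTo m)) (cong ι (Listₚ.length-upTo m))) ⟩
  ι m * colorings g m ∎

∑-𝟙≟* : ∀ {x xs} (f : ℕ → ℚ) → Unique xs → x ∈ xs → (∑[ y ∈ xs ] (𝟙 (x ℕₚ.≟ y) * f y)) ≡ f x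
∑-𝟙≟* {x} {xs} f u x∈ = begin
  (∑[ y ∈ xs ] (𝟙 (x ℕₚ.≟ y) * f y))  ≡⟨ ∑-cong xs (λ y → pick (x ℕₚ.≟ y)) ⟩
  (∑[ y ∈ xs ] (𝟙 (x ℕₚ.≟ y) * f x))  ≡⟨ ∑-*ʳ (f x) xs (λ y → 𝟙 (x ℕₚ.≟ y)) ⟩
  (∑[ y ∈ xs ] 𝟙 (x ℕₚ.≟ y)) * f x    ≡⟨ cong (_* f x) (∑-𝟙≟ {_≟_ = ℕₚ._≟_} u x∈) ⟩
  1ℚ * f x                            ≡⟨ ℚₚ.*-identityˡ (f x) ⟩
  f x                                 ∎
  where
  pick : ∀ {y} (d : Dec (x ≡ y)) → 𝟙 d * f y ≡ 𝟙 d * f x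
  pick (yes refl) = refl
  pick {y} (no _) = trans (ℚₚ.*-zeroˡ (f y)) (sym (ℚₚ.*-zeroˡ (f x)))

𝟙-¬ : ∀ {P : Set} (d : Dec P) → 1ℚ ≡ 𝟙 (¬? d) + 𝟙 d
𝟙-¬ (yes _) = refl
𝟙-¬ (no  _) = refl

-- Deletion and contraction: the colourings without the edge are split by whether the new vertex has
-- the colour of `u`. If it has, its colour is determined by `κ`, and its other edges become edges
-- at `u`. The hypothesis `u ∉ us` keeps these from being loops.
colorings-edge : ∀ {n} {u : Fin n} {us} → u ∉ us → ∀ g m →
  colorings (us ▹ g) m ≡ colorings ((u ∷ us) ▹ g) m + colorings (addEdges u us g) m
colorings-edge {n} {u} {us} u∉ g m = begin
  colorings (us ▹ g) m
    ≡⟨ colorings-▹ us g m ⟩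
  (∑[ κ ∈ K ] ∑[ a ∈ upTo m ] (avoids a us κ * proper g κ))
    ≡⟨ ∑-cong-∈ K split ⟩
  (∑[ κ ∈ K ] ((∑[ a ∈ upTo m ] (avoids a (u ∷ us) κ * proper g κ)) + proper (addEdges u us g) κ))
    ≡⟨ ∑-+ K (λ κ → ∑[ a ∈ upTo m ] (avoids a (u ∷ us) κ * proper g κ)) (proper (addEdges u us g)) ⟩
  (∑[ κ ∈ K ] ∑[ a ∈ upTo m ] (avoids a (u ∷ us) κ * proper g κ)) + colorings (addEdges u us g) m
    ≡⟨ cong (_+ colorings (addEdges u us g) m) (sym (colorings-▹ (u ∷ us) g m)) ⟩
  colorings ((u ∷ us) ▹ g) m + colorings (addEdges u us g) m ∎
  where
  K = vectors (upTo m) n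
  split : ∀ {κ} → κ ∈ K → (∑[ a ∈ upTo m ] (avoids a us κ * proper g κ)) ≡
    (∑[ a ∈ upTo m ] (avoids a (u ∷ us) κ * proper g κ)) + proper (addEdges u us g) κ
  split {κ} κ∈ = begin
    ∑ (upTo m) f
      ≡⟨ ∑-cong (upTo m) (λ a → trans
           (trans (sym (ℚₚ.*-identityˡ (f a)))
             (cong (_* f a) (trans (𝟙-¬ (x ℕₚ.≟ a)) (cong (_+ 𝟙 (x ℕₚ.≟ a)) (unequal-sym x a)))))
           (solve 4 (λ i j s t → (i :+ j) :* (s :* t) := i :* s :* t :+ j :* (s :* t)) refl
             (unequal a x) (𝟙 (x ℕₚ.≟ a)) (avoids a us κ) (proper g κ))) ⟩
    (∑[ a ∈ upTo m ] (avoids a (u ∷ us) κ * proper g κ + 𝟙 (x ℕₚ.≟ a) * f a))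
      ≡⟨ ∑-+ (upTo m) (λ a → avoids a (u ∷ us) κ * proper g κ) (λ a → 𝟙 (x ℕₚ.≟ a) * f a) ⟩
    deleted + (∑[ a ∈ upTo m ] (𝟙 (x ℕₚ.≟ a) * f a))
      ≡⟨ cong (deleted +_) (trans
           (∑-𝟙≟* f (Uniqueₚ.upTo⁺ m) (∈-vectors⇒lookup∈ κ∈ u))
           (sym (proper-addEdges u∉ g κ))) ⟩
    deleted + proper (addEdges u us g) κ ∎
    where
    x = lookup κ u
    f : ℕ → ℚ
    f a = avoids a us κ * proper g κ
    deleted = ∑[ a ∈ upTo m ] (avoids a (u ∷ us) κ * proper g κ)

avoids-∈ : ∀ {n a} {u : Fin n} {us} → u ∈ us → ∀ κ → unequal a (lookup κ u) * avoids a us κ ≡ avoids a us κ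
avoids-∈ {a = a} {u} {_ ∷ us} (here refl) κ = trans
  (sym (ℚₚ.*-assoc (unequal a (lookup κ u)) (unequal a (lookup κ u)) (avoids a us κ)))
  (cong (_* avoids a us κ) (idem (¬? (a ℕₚ.≟ lookup κ u))))
  where
  idem : ∀ {P : Set} (d : Dec P) → 𝟙 d * 𝟙 d ≡ 𝟙 d
  idem (yes _) = refl
  idem (no  _) = refl
avoids-∈ {a = a} {u} {v ∷ us} (there u∈) κ = trans
  (solve 3 (λ x y z → x :* (y :* z) := y :* (x :* z)) refl
    (unequal a (lookup κ u)) (unequal a (lookup κ v)) (avoids a us κ))
  (cong (unequal a (lookup κ v) *_) (avoids-∈ u∈ κ))

colorings-parallel : ∀ {n} {u : Fin n} {us} → u ∈ us → ∀ g m →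
  colorings ((u ∷ us) ▹ g) m ≡ colorings (us ▹ g) m
colorings-parallel {n} {u} {us} u∈ g m = ∑-cong (vectors (upTo m) (suc n))
  λ { (a ∷ κ) → cong (_* proper g κ) (avoids-∈ u∈ κ) }

sign : ℕ → ℚ
sign zero    = 1ℚ
sign (suc n) = - 1ℚ * sign n

-- By Stanley's theorem, a is the number of acyclic orientations of g.

Orientations : ∀ {n} → Layered n → ℚ → Set
Orientations {n} g a = Ext (suc n) (colorings g) (sign n * a)

orientations-∅ : Orientations ∅ 1ℚ
orientations-∅ = (λ m → refl) , refl

orientations-isolated : ∀ {n} {g : Layered n} {a} → Orientations g a → Orientations ([] ▹ g) a
orientations-isolated {n} {g} {a} o = Ext-cong (suc (suc n))
  (λ m → sym (colorings-isolated g m))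
  (solve 2 (λ s a → :- (s :* a) := con (- 1ℚ) :* s :* a) refl (sign n) a)
  (Ext-ι* (suc n) {colorings g} {sign n * a} o)

-- Contraction loses a vertex and therefore has the opposite sign at -1, which turns the difference
-- of colouring counts into a sum.
orientations-edge : ∀ {n} {g : Layered n} {u us a b} → u ∉ us →
  Orientations (us ▹ g) a → Orientations (addEdges u us g) b → Orientations ((u ∷ us) ▹ g) (a + b)
orientations-edge {n} {g} {u} {us} {a} {b} u∉ o o′ = Ext-cong (suc (suc n))
  (λ m → trans (cong (_- contracted m) (colorings-edge u∉ g m))
    (solve 2 (λ x y → x :+ y :- y := x) refl (colorings ((u ∷ us) ▹ g) m) (contracted m)))
  (solve 3 (λ s a b → con (- 1ℚ) :* s :* a :- s :* b := con (- 1ℚ) :* s :* (a :+ b)) refl (sign n) a b)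
  (Ext-- (suc (suc n)) {colorings (us ▹ g)} {contracted} {sign (suc n) * a} {sign n * b} o
    (Ext-weaken (suc n) {contracted} {sign n * b} o′))
  where contracted = colorings (addEdges u us g)

orientations-parallel : ∀ {n} {g : Layered n} {u us a} → u ∈ us →
  Orientations (us ▹ g) a → Orientations ((u ∷ us) ▹ g) a
orientations-parallel {n} {g} {us = us} {a} u∈ o =
  Ext-cong (suc (suc n)) {colorings (us ▹ g)} {c = sign (suc n) * a}
    (λ m → sym (colorings-parallel u∈ g m)) refl o

_∈?_ : ∀ {n} (u : Fin n) us → Dec (u ∈ us)
u ∈? us = any? (u Finₚ.≟_) us

-- Contraction lowers the number of vertices, and deletion shortens the list of the newest vertex at
-- a fixed number of vertices. All signs having been absorbed, the counts are only ever added, so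
-- they stay nonnegative.
orientations : ∀ n (g : Layered n) → Σ[ a ∈ ℚ ] (Orientations g a × 0ℚ ≤ a)
orientations zero    ∅        = 1ℚ , orientations-∅ , ℚₚ.nonNegative⁻¹ 1ℚ
orientations (suc n) (us ▹ g) = star us
  where
  star : ∀ us → Σ[ a ∈ ℚ ] (Orientations (us ▹ g) a × 0ℚ ≤ a)
  star [] = let a , o , a≥0 = orientations n g in a , orientations-isolated {g = g} {a} o , a≥0
  star (u ∷ us) with star us | u ∈? us
  ... | a , o , a≥0 | yes u∈ = a , orientations-parallel {g = g} {a = a} u∈ o , a≥0
  ... | a , o , a≥0 | no u∉ =
    let b , o′ , b≥0 = orientations n (addEdges u us g)
    in a + b , orientations-edge {g = g} {a = a} {b} u∉ o o′ , ℚₚ.+-mono-≤ a≥0 b≥0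

-- Deleting the only edge at the new vertex isolates it, and contracting that edge gives back `g`;
-- both have count `a`. Further entries of the list are copies of the same edge.
orientations-leaf : ∀ {n} {g : Layered n} {a u us} → Orientations g a → All (u ≡_) us →
                    Orientations ((u ∷ us) ▹ g) (a + a)
orientations-leaf {g = g} {a} o [] =
  orientations-edge {g = g} {a = a} {a} (λ ()) (orientations-isolated {g = g} {a} o) o
orientations-leaf {g = g} {a} o (refl ∷ ps) =
  orientations-parallel {g = g} {a = a + a} (here refl) (orientations-leaf {g = g} {a} o ps)

-- A new vertex with a neighbour can be made a source or a sink.

orientations-attach : ∀ {n} {g : Layered n} {a} u us → Orientations g a →
                      Σ[ b ∈ ℚ ] (Orientations ((u ∷ us) ▹ g) b × a + a ≤ b)
orientations-attach {g = g} {a} u [] o = a + a , orientations-leaf {g = g} {a} o [] , ℚₚ.≤-refl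
orientations-attach {n} {g} {a} u (v ∷ us) o
  with orientations-attach {g = g} {a} v us o | u ∈? (v ∷ us)
... | b , o′ , le | yes u∈ = b , orientations-parallel {g = g} {a = b} u∈ o′ , le
... | b , o′ , le | no u∉ =
  let c , o″ , c≥0 = orientations n (addEdges u (v ∷ us) g)
  in b + c , orientations-edge {g = g} {a = b} {c} u∉ o′ o″ ,
     ℚₚ.≤-trans (ℚₚ.≤-reflexive (sym (ℚₚ.+-identityʳ (a + a)))) (ℚₚ.+-mono-≤ le c≥0)

-- Relabelling the vertices

vec-ext : ∀ {A : Set} {n} {xs ys : Vec A n} → (∀ i → lookup xs i ≡ lookup ys i) → xs ≡ ys
vec-ext {xs = xs} {ys} eq = trans (sym (Vecₚ.tabulate∘lookup xs))
  (trans (Vecₚ.tabulate-cong eq) (Vecₚ.tabulate∘lookup ys))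

-- Composing with a bijection of the vertices permutes the colourings: the two lists have no
-- repetitions and the same members.
∑-relabel : ∀ {n m} {vs : Vec (Fin n) n} →
  (∀ {i j} → lookup vs i ≡ lookup vs j → i ≡ j) → (∀ v → v ∈ᵥ vs) →
  (f : Vec ℕ n → ℚ) →
  (∑[ κ ∈ vectors (upTo m) n ] f (Vec.map (lookup κ) vs)) ≡ ∑ (vectors (upTo m) n) f
∑-relabel {n} {m} {vs} injective covers f = trans
  (sym (∑-map φ K f))
  (∑-↭ f (∼bag⇒↭ (unique∧set⇒bag (Uniqueₚ.map⁺ φ-injective K!) K! (mk⇔ into onto))))
  where
  K = vectors (upTo m) n
  K! = vectors-unique (Uniqueₚ.upTo⁺ m) n
  φ : Vec ℕ n → Vec ℕ n
  φ κ = Vec.map (lookup κ) vs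
  lookup-φ : ∀ κ i → lookup (φ κ) i ≡ lookup κ (lookup vs i)
  lookup-φ κ i = Vecₚ.lookup-map i (lookup κ) vs
  position : Fin n → Fin n
  position v = VecAny.index (covers v)
  lookup-position : ∀ v → v ≡ lookup vs (position v)
  lookup-position v = lookup-index (covers v)
  φ-injective : ∀ {κ κ′} → φ κ ≡ φ κ′ → κ ≡ κ′
  φ-injective {κ} {κ′} eq = vec-ext λ v → begin
    lookup κ v                           ≡⟨ cong (lookup κ) (lookup-position v) ⟩
    lookup κ (lookup vs (position v))    ≡⟨ sym (lookup-φ κ (position v)) ⟩
    lookup (φ κ) (position v)            ≡⟨ cong (λ κ″ → lookup κ″ (position v)) eq ⟩
    lookup (φ κ′) (position v)           ≡⟨ lookup-φ κ′ (position v) ⟩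
    lookup κ′ (lookup vs (position v))   ≡⟨ cong (lookup κ′) (sym (lookup-position v)) ⟩
    lookup κ′ v                          ∎
  into : ∀ {κ} → κ ∈ map φ K → κ ∈ K
  into κ∈ with ∈ₚ.∈-map⁻ φ κ∈
  ... | κ , κ∈K , refl = lookup∈⇒∈-vectors (φ κ) λ i →
    subst (_∈ upTo m) (sym (lookup-φ κ i)) (∈-vectors⇒lookup∈ κ∈K (lookup vs i))
  onto : ∀ {κ} → κ ∈ K → κ ∈ map φ K
  onto {κ} κ∈ = subst (_∈ map φ K) φκ′≡κ
    (∈ₚ.∈-map⁺ φ (lookup∈⇒∈-vectors κ′ λ v →
      subst (_∈ upTo m) (sym (lookup-κ′ v)) (∈-vectors⇒lookup∈ κ∈ (position v))))
    where
    κ′ = Vec.tabulate (lookup κ ∘ position)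
    lookup-κ′ : ∀ v → lookup κ′ v ≡ lookup κ (position v)
    lookup-κ′ v = Vecₚ.lookup∘tabulate (lookup κ ∘ position) v
    φκ′≡κ : φ κ′ ≡ κ
    φκ′≡κ = vec-ext λ i → begin
      lookup (φ κ′) i                   ≡⟨ lookup-φ κ′ i ⟩
      lookup κ′ (lookup vs i)           ≡⟨ lookup-κ′ (lookup vs i) ⟩
      lookup κ (position (lookup vs i)) ≡⟨ cong (lookup κ) (sym (injective (lookup-position (lookup vs i)))) ⟩
      lookup κ i                        ∎

pow2 : ℕ → ℚ
pow2 zero    = 1ℚ
pow2 (suc n) = pow2 n + pow2 n

-- The layered form of a graph

module _ {n} (G : Graph n) where
  open Graph G
  open DecMembership (Finₚ._≟_ {n}) using () renaming (_∈?_ to _∈ᵥ?_)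

  neighbours : ∀ {k} → Fin n → Vec (Fin n) k → List (Fin k)
  neighbours {k} w vs = filter (λ i → w ~? lookup vs i) (allFin k)

  adjacent : ∀ {k w i} {vs : Vec (Fin n) k} → i ∈ neighbours w vs → w ~ lookup vs i
  adjacent {k} {w} {vs = vs} i∈ = proj₂ (∈ₚ.∈-filter⁻ (λ i → w ~? lookup vs i) {xs = allFin k} i∈)

  layered : ∀ {k} → Vec (Fin n) k → Layered k
  layered []       = ∅
  layered (w ∷ vs) = neighbours w vs ▹ layered vs

  avoids-𝟙 : ∀ {k} a (us : List (Fin k)) κ → avoids a us κ ≡ 𝟙 (All.all? (λ u → ¬? (a ℕₚ.≟ lookup κ u)) us)
  avoids-𝟙 a []       κ = refl
  avoids-𝟙 a (u ∷ us) κ = trans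
    (cong (unequal a (lookup κ u) *_) (avoids-𝟙 a us κ))
    (sym (𝟙-× (All.all? (λ u → ¬? (a ℕₚ.≟ lookup κ u)) (u ∷ us)) (¬? (a ℕₚ.≟ lookup κ u))
      (All.all? (λ u → ¬? (a ℕₚ.≟ lookup κ u)) us) (λ { (p ∷ ps) → p , ps }) _∷_))

  ProperOn : ∀ {k} → Vec (Fin n) k → Vec ℕ k → Set
  ProperOn vs κ = ∀ i j → lookup vs i ~ lookup vs j → lookup κ i ≢ lookup κ j

  properOn? : ∀ {k} (vs : Vec (Fin n) k) κ → Dec (ProperOn vs κ)
  properOn? vs κ = Finₚ.all? λ i → Finₚ.all? λ j →
    (lookup vs i ~? lookup vs j) →-dec ¬? (lookup κ i ℕₚ.≟ lookup κ j)

  proper-layered : ∀ {k} (vs : Vec (Fin n) k) κ → proper (layered vs) κ ≡ 𝟙 (properOn? vs κ)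
  proper-layered []           []      = refl
  proper-layered {suc k} (w ∷ vs) (a ∷ κ) = trans
    (cong₂ _*_ (avoids-𝟙 a (neighbours w vs) κ) (proper-layered vs κ))
    (sym (𝟙-× (properOn? (w ∷ vs) (a ∷ κ)) (All.all? (λ u → ¬? (a ℕₚ.≟ lookup κ u)) (neighbours w vs))
      (properOn? vs κ)
      (λ p → All.tabulate (λ {i} i∈ → p zero (suc i) (adjacent {vs = vs} i∈)) , λ i j → p (suc i) (suc j))
      combine))
    where
    combine : All (λ u → a ≢ lookup κ u) (neighbours w vs) → ProperOn vs κ → ProperOn (w ∷ vs) (a ∷ κ)
    combine p q zero    zero    e = contradiction e (~-irrefl refl)
    combine p q zero    (suc j) e = All.lookup p (∈ₚ.∈-filter⁺ (λ i → w ~? lookup vs i) (∈ₚ.∈-allFin j) e)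
    combine p q (suc i) zero    e =
      All.lookup p (∈ₚ.∈-filter⁺ (λ i → w ~? lookup vs i) (∈ₚ.∈-allFin i) (~-sym e)) ∘ sym
    combine p q (suc i) (suc j) e = q i j e

  total-layered : (vs : Vec (Fin n) n) →
    (∀ {i j} → lookup vs i ≡ lookup vs j → i ≡ j) → (∀ v → v ∈ᵥ vs) →
    ∀ m → total n (X G) m ≡ colorings (layered vs) m
  total-layered vs injective covers m = begin
    total n (X G) m
      ≡⟨ total-X G m ⟩
    (∑[ κ ∈ vectors (upTo m) n ] 𝟙 (proper? G κ))
      ≡⟨ ∑-cong (vectors (upTo m) n) (λ κ → trans
           (𝟙-cong (proper? G κ) (properOn? vs (Vec.map (lookup κ) vs)) (pull κ) (push κ))
           (sym (proper-layered vs (Vec.map (lookup κ) vs)))) ⟩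
    (∑[ κ ∈ vectors (upTo m) n ] proper (layered vs) (Vec.map (lookup κ) vs))
      ≡⟨ ∑-relabel injective covers (proper (layered vs)) ⟩
    colorings (layered vs) m ∎
    where
    pull : ∀ κ → Proper G κ → ProperOn vs (Vec.map (lookup κ) vs)
    pull κ p i j e rewrite Vecₚ.lookup-map i (lookup κ) vs | Vecₚ.lookup-map j (lookup κ) vs =
      p (lookup vs i) (lookup vs j) e
    push : ∀ κ → ProperOn vs (Vec.map (lookup κ) vs) → Proper G κ
    push κ p u v with lookup-index (covers u) | lookup-index (covers v)
    ... | eq | eq′ with p (VecAny.index (covers u)) (VecAny.index (covers v))
    ...   | q rewrite Vecₚ.lookup-map (VecAny.index (covers u)) (lookup κ) vs
                    | Vecₚ.lookup-map (VecAny.index (covers v)) (lookup κ) vs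
                    | sym eq | sym eq′ = q

  -- Growing a connected graph vertex by vertex

  data Growth : ∀ {k} → Vec (Fin n) (suc k) → Set where
    root : ∀ v → Growth (v ∷ [])
    grow : ∀ {k w u} {vs : Vec (Fin n) (suc k)} →
           w ∉ᵥ vs → u ∈ᵥ vs → w ~ u → Growth vs → Growth (w ∷ vs)

  growth-injective : ∀ {k} {vs : Vec (Fin n) (suc k)} → Growth vs →
                     ∀ {i j} → lookup vs i ≡ lookup vs j → i ≡ j
  growth-injective g              {zero}  {zero}  eq = refl
  growth-injective (grow w∉ _ _ _) {zero}  {suc j} refl = contradiction (∈-lookup j _) w∉
  growth-injective (grow w∉ _ _ _) {suc i} {zero}  refl = contradiction (∈-lookup i _) w∉
  growth-injective (grow _ _ _ g) {suc i} {suc j} eq = cong suc (growth-injective g eq)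

  crossing : ∀ {k} {vs : Vec (Fin n) k} {x y} → x ∈ᵥ vs → y ∉ᵥ vs → Star _~_ x y →
             ∃ λ a → ∃ λ b → a ∈ᵥ vs × b ∉ᵥ vs × b ~ a
  crossing x∈ y∉ done = contradiction x∈ y∉
  crossing {vs = vs} x∈ y∉ (_◅_ {j = z} x~z walk) with z ∈ᵥ? vs
  ... | yes z∈ = crossing z∈ y∉ walk
  ... | no  z∉ = _ , z , x∈ , z∉ , ~-sym x~z

  covers-or-misses : ∀ {k} (vs : Vec (Fin n) k) → (∀ v → v ∈ᵥ vs) ⊎ ∃ (_∉ᵥ vs)
  covers-or-misses vs with Finₚ.all? (_∈ᵥ? vs)
  ... | yes all = inj₁ all
  ... | no ¬all = inj₂ (Finₚ.¬∀⟶∃¬ n (_∈ᵥ vs) (_∈ᵥ? vs) ¬all)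

  grow-all : (∀ u v → Star _~_ u v) → ∀ fuel {k} {vs : Vec (Fin n) (suc k)} → Growth vs →
             n ℕ.≤ fuel ℕ.+ suc k →
             ∃ λ k → Σ[ vs ∈ Vec (Fin n) (suc k) ] Growth vs × (∀ v → v ∈ᵥ vs)
  grow-all walk fuel {k} {vs@(r ∷ _)} g n≤ with covers-or-misses vs
  ... | inj₁ covers = k , vs , g , covers
  ... | inj₂ (w , w∉) with crossing {vs = vs} (here refl) w∉ (walk r w) | fuel
  -- The fuel bounds the number of missing vertices. At zero, n ≤ `suc k`, while adding `b` would
  -- give `suc (suc k)` distinct vertices among n.
  ...   | a , b , a∈ , b∉ , b~a | zero     =
    contradiction (Finₚ.injective⇒≤ (growth-injective (grow b∉ a∈ b~a g))) (ℕₚ.≤⇒≯ n≤)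
  ...   | a , b , a∈ , b∉ , b~a | suc fuel =
    grow-all walk fuel (grow b∉ a∈ b~a g) (subst (n ℕ.≤_) (sym (ℕₚ.+-suc fuel (suc k))) n≤)

  ∈-neighbours : ∀ {k w u} {vs : Vec (Fin n) k} (u∈ : u ∈ᵥ vs) → w ~ u → VecAny.index u∈ ∈ neighbours w vs
  ∈-neighbours {w = w} {vs = vs} u∈ w~u = ∈ₚ.∈-filter⁺ (λ i → w ~? lookup vs i)
    (∈ₚ.∈-allFin (VecAny.index u∈)) (subst (w ~_) (lookup-index u∈) w~u)

  -- The root has count 1, and each of the k later vertices has a neighbour already present, so it
  -- at least doubles the count.
  orientations-≥ : ∀ {k} {vs : Vec (Fin n) (suc k)} → Growth vs →
                   Σ[ b ∈ ℚ ] (Orientations (layered vs) b × pow2 k ≤ b)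
  orientations-≥ (root v) =
    1ℚ , orientations-isolated {g = ∅} {1ℚ} orientations-∅ , ℚₚ.≤-refl
  orientations-≥ (grow {k} {w} {vs = vs} _ u∈ w~u g)
    with neighbours w vs | ∈-neighbours u∈ w~u | orientations-≥ g
  ... | u ∷ us | _ | a , o , le =
    let b , o′ , le′ = orientations-attach {g = layered vs} {a} u us o
    in b , o′ , ℚₚ.≤-trans (ℚₚ.+-mono-≤ le le) le′

  -- Paths and cycles in a grown graph

  data Path : Fin n → Fin n → List (Fin n) → Set where
    stop : ∀ {x} → Path x x [ x ]
    step : ∀ {x y z ws} → x ~ z → Path z y ws → Path x y (x ∷ ws)

  path-snoc : ∀ {x y z ws} → Path x y ws → y ~ z → Path x z (ws ++ [ z ])
  path-snoc stop       y~z = step y~z stop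
  path-snoc (step e p) y~z = step e (path-snoc p y~z)

  path-linked : ∀ {x y ws} → Path x y ws → Linked _~_ ws
  path-linked stop                   = [-]
  path-linked (step e stop)          = e ∷ [-]
  path-linked (step e p@(step _ _)) = e ∷ path-linked p

  SimplePath : ∀ {k} → Vec (Fin n) k → Fin n → Fin n → Set
  SimplePath vs x y = ∃ λ ws → Path x y ws × Unique ws × All (_∈ᵥ vs) ws

  -- The path follows the attaching edges. That it stays inside `vs` is recorded because this makes
  -- it avoid the vertex added next, so it remains simple when extended.
  growth-path : ∀ {k} {vs : Vec (Fin n) (suc k)} → Growth vs →
                ∀ {x y} → x ∈ᵥ vs → y ∈ᵥ vs → SimplePath vs x y
  growth-path (root v) (here refl) (here refl) = [ v ] , stop , [] ∷ [] , here refl ∷ []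
  growth-path (grow _ _ _ _) (here refl) (here refl) = _ , stop , [] ∷ [] , here refl ∷ []
  growth-path (grow {w = w} w∉ u∈ w~u g) (here refl) (there y∈) =
    let ws , p , ws! , ws∈ = growth-path g u∈ y∈ in
    w ∷ ws , step w~u p , All.map (λ { v∈ refl → w∉ v∈ }) ws∈ ∷ ws! , here refl ∷ All.map there ws∈
  growth-path (grow {w = w} w∉ u∈ w~u g) (there x∈) (here refl) =
    let ws , p , ws! , ws∈ = growth-path g x∈ u∈ in
    ws ++ [ w ] , path-snoc p (~-sym w~u) ,
    Uniqueₚ.++⁺ ws! ([] ∷ []) (λ { (w∈ , here refl) → w∉ (All.lookup ws∈ w∈) }) ,
    Allₚ.++⁺ (All.map there ws∈) (here refl ∷ [])
  growth-path (grow _ _ _ g) (there x∈) (there y∈) =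
    let ws , p , ws! , ws∈ = growth-path g x∈ y∈ in ws , p , ws! , All.map there ws∈

  -- A simple path from `x` to `y` inside `vs` closes up through the outside vertex `w`; `x ≢ y`
  -- gives the path the two vertices that a cycle requires.
  growth-cycle : ∀ {k} {vs : Vec (Fin n) (suc k)} → Growth vs →
                 ∀ {w x y} → w ∉ᵥ vs → x ∈ᵥ vs → y ∈ᵥ vs → x ≢ y → w ~ x → w ~ y → Cycle G
  growth-cycle g {w} w∉ x∈ y∈ x≢y w~x w~y =
    let ws , p , ws! , ws∈ = growth-path g x∈ y∈ in record
    { v        = w
    ; ws       = ws
    ; long     = long p x≢y
    ; distinct = All.map (λ { v∈ refl → w∉ v∈ }) ws∈ ∷ ws!
    ; closed   = path-linked (step w~x (path-snoc p (~-sym w~y)))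
    }
    where
    long : ∀ {x y ws} → Path x y ws → x ≢ y → 2 ℕ.≤ length ws
    long stop                x≢y = contradiction refl x≢y
    long (step _ stop)       _   = s≤s (s≤s z≤n)
    long (step _ (step _ _)) _   = s≤s (s≤s z≤n)

  -- A second neighbour of the new vertex inside `vs` would close a cycle, so every vertex after the
  -- root is attached as a leaf.
  orientations-tree : ¬ Cycle G → ∀ {k} {vs : Vec (Fin n) (suc k)} → Growth vs →
                      Orientations (layered vs) (pow2 k)
  orientations-tree _ (root v) = orientations-isolated {g = ∅} {1ℚ} orientations-∅
  orientations-tree acyclic (grow {suc-k} {w} {vs = vs} w∉ u∈ w~u g) =
    attach (neighbours w vs) (∈-neighbours u∈ w~u) unique-neighbour
    where
    unique-neighbour : ∀ {i j} → i ∈ neighbours w vs → j ∈ neighbours w vs → i ≡ j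
    unique-neighbour {i} {j} i∈ j∈ with i Finₚ.≟ j
    ... | yes eq = eq
    ... | no i≢j = contradiction
      (growth-cycle g w∉ (∈-lookup i vs) (∈-lookup j vs) (i≢j ∘ growth-injective g)
        (adjacent {vs = vs} i∈) (adjacent {vs = vs} j∈))
      acyclic
    attach : ∀ us {i} → i ∈ us → (∀ {i j} → i ∈ us → j ∈ us → i ≡ j) →
             Orientations (us ▹ layered vs) (pow2 suc-k + pow2 suc-k)
    attach (u ∷ us) _ same = orientations-leaf {g = layered vs} {pow2 suc-k}
      (orientations-tree acyclic g) (All.tabulate (λ j∈ → same (here refl) (there j∈)))

-- Chromatic polynomials at -1

enumeration : ∀ {n} {G : Graph (suc n)} → Connected G →
              Σ[ vs ∈ Vec (Fin (suc n)) (suc n) ] Growth G vs × (∀ v → v ∈ᵥ vs)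
enumeration {n} {G} conn
  with grow-all G (Connected.walk conn) n (root zero) (ℕₚ.≤-reflexive (ℕₚ.+-comm 1 n))
... | k , vs , g , covers
  -- The final length is that of the whole vertex set: at least, because every vertex has a position
  -- in `vs`, and at most, because the entries are distinct.
  with ℕₚ.≤-antisym
    (Finₚ.injective⇒≤ {f = λ v → VecAny.index (covers v)} λ {u} {v} eq →
      trans (lookup-index (covers u)) (trans (cong (lookup vs) eq) (sym (lookup-index (covers v)))))
    (Finₚ.injective⇒≤ (growth-injective G g))
...   | refl = vs , g , covers

total-Ext : ∀ {n} {G : Graph (suc n)} {vs a} → Growth G vs → (∀ v → v ∈ᵥ vs) →
            Orientations (layered G vs) a →
            Ext (suc (suc n)) (total (suc n) (X G)) (sign (suc n) * a)
total-Ext {n} {G} {vs} {a} g covers =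
  Ext-cong (suc (suc n)) {colorings (layered G vs)} {total (suc n) (X G)} {sign (suc n) * a}
    (λ m → sym (total-layered G vs (growth-injective G g) covers m)) refl

total-connected : ∀ {n} {G : Graph (suc n)} → Connected G →
  Σ[ b ∈ ℚ ] (Ext (suc (suc n)) (total (suc n) (X G)) (sign (suc n) * b) × pow2 n ≤ b)
total-connected {G = G} conn =
  let vs , g , covers = enumeration conn
      b , o , le = orientations-≥ G g
  in b , total-Ext {G = G} {vs} {b} g covers o , le

total-tree : ∀ {n} {G : Graph (suc n)} → IsTree G →
  Ext (suc (suc n)) (total (suc n) (X G)) (sign (suc n) * pow2 n)
total-tree {n} {G} t =
  let vs , g , covers = enumeration (IsTree.connected t)
  in total-Ext {G = G} {vs} {pow2 n} g covers (orientations-tree G (IsTree.acyclic t) g)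

-- The coefficient of x₀ ⋯ xₙ₋₁

count : ℕ → List ℕ → ℕ
count i w = length (filter (i ℕₚ.≟_) w)

count-unique : ∀ {i w} → Unique w → i ∈ w → count i w ≡ 1
count-unique {i} {_ ∷ w} (i∉ ∷ _) (here refl) = trans
  (cong length (Listₚ.filter-accept (i ℕₚ.≟_) {i} {w} refl))
  (cong (suc ∘ length) (Listₚ.filter-none (i ℕₚ.≟_) i∉))
count-unique {i} {x ∷ w} (x∉ ∷ w!) (there i∈) = trans
  (cong length (Listₚ.filter-reject (i ℕₚ.≟_) {x} {w} λ { refl → All.lookup x∉ i∈ refl }))
  (count-unique w! i∈)

count-here : ∀ c w → count c (c ∷ w) ≡ suc (count c w)
count-here c w = cong length (Listₚ.filter-accept (c ℕₚ.≟_) {c} {w} refl)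

count-∷ : ∀ i c w → count i w ℕ.≤ count i (c ∷ w)
count-∷ i c w with i ℕ.≡ᵇ c
... | true  = ℕₚ.n≤1+n _
... | false = ℕₚ.≤-refl

count-≥1 : ∀ {n} (κ : Vec ℕ n) v → 1 ℕ.≤ count (lookup κ v) (toList κ)
count-≥1 (c ∷ κ) zero    = subst (1 ℕ.≤_) (sym (count-here c (toList κ))) (s≤s z≤n)
count-≥1 (c ∷ κ) (suc v) = ℕₚ.≤-trans (count-≥1 κ v) (count-∷ (lookup κ v) c (toList κ))

count-injective : ∀ {n} (κ : Vec ℕ n) {u v} → lookup κ u ≡ lookup κ v →
                  count (lookup κ u) (toList κ) ℕ.≤ 1 → u ≡ v
count-injective (c ∷ κ) {zero}  {zero}  eq   le = refl
count-injective (c ∷ κ) {zero}  {suc v} refl le = contradiction (count-≥1 κ v)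
  (ℕₚ.<⇒≱ (subst (ℕ._≤ 1) (count-here c (toList κ)) le))
count-injective (c ∷ κ) {suc u} {zero}  refl le = contradiction (count-≥1 κ u)
  (ℕₚ.<⇒≱ (subst (ℕ._≤ 1) (count-here c (toList κ)) le))
count-injective (c ∷ κ) {suc u} {suc v} eq   le =
  cong suc (count-injective κ eq (ℕₚ.≤-trans (count-∷ (lookup κ u) c (toList κ)) le))

content-1^⇒count : ∀ {k n w i} → content k w ≡ 1^ n → i ∈ upTo k → count i w ≡ 1
content-1^⇒count {k} {n} {w} eq i∈ =
  All.lookup (Allₚ.map⁻ (subst (All (_≡ 1)) (sym eq) (Allₚ.replicate⁺ n refl))) i∈

-- Content `1^ n` makes the colours pairwise distinct, and such a colouring is proper for every
-- graph. The right side does not mention `G`, which gives the same coefficient for any two graphs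
-- on n vertices.
X-1^ : ∀ {n} (G : Graph n) → let k = length (1^ n) in
       X G (1^ n) ≡ (∑[ w ∈ words (upTo k) n ] 𝟙 (content-≟ k w (1^ n)))
X-1^ {n} G = begin
  X G (1^ n)
    ≡⟨ ∑x-𝟙 (λ k → map toList (filter (proper? G) (vectors (upTo k) n))) (1^ n) refl ⟩
  ∑ (map toList (filter (proper? G) V)) c
    ≡⟨ ∑-map toList (filter (proper? G) V) c ⟩
  ∑ (filter (proper? G) V) (c ∘ toList)
    ≡⟨ ∑-filter (proper? G) V (c ∘ toList) ⟩
  (∑[ κ ∈ V ] (𝟙 (proper? G κ) * c (toList κ)))
    ≡⟨ ∑-cong-∈ V absorb ⟩
  ∑ V (c ∘ toList)
    ≡⟨ sym (∑-map toList V c) ⟩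
  ∑ (words (upTo k) n) c ∎
  where
  open Graph G
  k = length (1^ n)
  V = vectors (upTo k) n
  c : List ℕ → ℚ
  c w = 𝟙 (content-≟ k w (1^ n))
  absorb : ∀ {κ} → κ ∈ V → 𝟙 (proper? G κ) * c (toList κ) ≡ c (toList κ)
  absorb {κ} κ∈ with content-≟ k (toList κ) (1^ n)
  ... | no _   = ℚₚ.*-zeroʳ (𝟙 (proper? G κ))
  ... | yes eq = trans (ℚₚ.*-identityʳ (𝟙 (proper? G κ))) (𝟙-yes (proper? G κ) λ u v u~v same →
    ~-irrefl (count-injective κ same
      (ℕₚ.≤-reflexive (content-1^⇒count {k} {n} {toList κ} eq (∈-vectors⇒lookup∈ κ∈ u)))) u~v)

-- The increasing word and the superstandard tableau

run : ℕ → ℕ → List ℕ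
run o zero    = []
run o (suc r) = o ∷ run (suc o) r

run-≥ : ∀ o r → All (o ℕ.≤_) (run o r)
run-≥ o zero    = []
run-≥ o (suc r) = ℕₚ.≤-refl ∷ All.map ℕₚ.<⇒≤ (run-≥ (suc o) r)

run-< : ∀ {k} o r → o ℕ.+ r ℕ.≤ k → All (ℕ._< k) (run o r)
run-< o zero    le = []
run-< o (suc r) le rewrite ℕₚ.+-suc o r =
  ℕₚ.≤-trans (s≤s (ℕₚ.m≤m+n o r)) le ∷ run-< (suc o) r le

run-unique : ∀ o r → Unique (run o r)
run-unique o zero    = []
run-unique o (suc r) = All.map ℕₚ.<⇒≢ (run-≥ (suc o) r) ∷ run-unique (suc o) r

∈-run : ∀ {i} o r → o ℕ.≤ i → i ℕ.< o ℕ.+ r → i ∈ run o r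
∈-run o zero    o≤i i< = contradiction o≤i (ℕₚ.<⇒≱ (ℕₚ.<-≤-trans i< (ℕₚ.≤-reflexive (ℕₚ.+-identityʳ o))))
∈-run {i} o (suc r) o≤i i< with o ℕₚ.≟ i
... | yes refl = here refl
... | no o≢i = there (∈-run (suc o) r (ℕₚ.≤∧≢⇒< o≤i o≢i) (subst (i ℕ.<_) (ℕₚ.+-suc o r) i<))

run-++ : ∀ o r r′ → run o r ++ run (o ℕ.+ r) r′ ≡ run o (r ℕ.+ r′)
run-++ o zero    r′ = cong (λ o → run o r′) (ℕₚ.+-identityʳ o)
run-++ o (suc r) r′ = cong (o ∷_) (trans
  (cong (λ o″ → run (suc o) r ++ run o″ r′) (ℕₚ.+-suc o r)) (run-++ (suc o) r r′))

length-run : ∀ o r → length (run o r) ≡ r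
length-run o zero    = refl
length-run o (suc r) = cong suc (length-run (suc o) r)

run-words : ∀ {k} o r → o ℕ.+ r ℕ.≤ k → run o r ∈ words (upTo k) r
run-words {k} o r le = subst (λ l → run o r ∈ words (upTo k) l) (length-run o r)
  (All∈⇒∈-words (All.map ∈ₚ.∈-upTo⁺ (run-< o r le)))

content-run : ∀ n → content n (run 0 n) ≡ 1^ n
content-run n = trans
  (ones (All.tabulate λ i∈ → count-unique (run-unique 0 n) (∈-run 0 n z≤n (∈ₚ.∈-upTo⁻ i∈))))
  (cong 1^ (Listₚ.length-upTo n))
  where
  ones : ∀ {is} → All (λ i → count i (run 0 n) ≡ 1) is →
         map (λ i → count i (run 0 n)) is ≡ replicate (length is) 1
  ones []       = refl
  ones (p ∷ ps) = cong₂ _∷_ p (ones ps)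

X-1^-pos : ∀ {n} (G : Graph n) → 0ℚ < X G (1^ n)
X-1^-pos {n} G = ℚₚ.<-≤-trans (ℚₚ.positive⁻¹ 1ℚ) (ℚₚ.≤-trans
  (ℚₚ.≤-reflexive (sym (𝟙-yes (content-≟ k (run 0 n) (1^ n)) content≡)))
  (ℚₚ.≤-trans
    (∑-≥-term (words (upTo k) n) {λ w → 𝟙 (content-≟ k w (1^ n))}
      (λ {w} _ → 𝟙-nonNeg (content-≟ k w (1^ n)))
      (run-words 0 n (ℕₚ.≤-reflexive (sym k≡n))))
    (ℚₚ.≤-reflexive (sym (X-1^ G)))))
  where
  k = length (1^ n)
  k≡n = Listₚ.length-replicate n {1}
  content≡ : content k (run 0 n) ≡ 1^ n
  content≡ = trans (cong (λ l → content l (run 0 n)) k≡n) (content-run n)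

-- The superstandard tableau, filled row by row with consecutive numbers from `o`. For `o` = 0 it
-- witnesses the monomial x₀ ⋯ xₙ₋₁ in the Schur function of shape `λs`.
rows : ℕ → List ℕ → Filling
rows o []       = []
rows o (r ∷ λs) = run o r ∷ rows (o ℕ.+ r) λs

concat-rows : ∀ o λs → concat (rows o λs) ≡ run o (sum λs)
concat-rows o []       = refl
concat-rows o (r ∷ λs) = trans (cong (run o r ++_) (concat-rows (o ℕ.+ r) λs)) (run-++ o r (sum λs))

rows-fillings : ∀ {k} o λs → o ℕ.+ sum λs ℕ.≤ k → rows o λs ∈ fillings k λs
rows-fillings o []       le = here refl
rows-fillings {k} o (r ∷ λs) le = ∈ₚ.∈-cartesianProductWith⁺ _∷_
  (run-words o r (ℕₚ.≤-trans (ℕₚ.m≤m+n (o ℕ.+ r) (sum λs)) le′))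
  (rows-fillings (o ℕ.+ r) λs le′)
  where le′ = subst (ℕ._≤ k) (sym (ℕₚ.+-assoc o r (sum λs))) le

rows-semistandard : ∀ o λs → Semistandard (rows o λs)
rows-semistandard o λs = all-sorted o λs , columns o λs
  where
  run-sorted : ∀ o r → Linked ℕ._≤_ (run o r)
  run-sorted o zero          = []
  run-sorted o (suc zero)    = [-]
  run-sorted o (suc (suc r)) = ℕₚ.n≤1+n o ∷ run-sorted (suc o) (suc r)
  all-sorted : ∀ o λs → All (Linked ℕ._≤_) (rows o λs)
  all-sorted o []       = []
  all-sorted o (r ∷ λs) = run-sorted o r ∷ all-sorted (o ℕ.+ r) λs
  run-above : ∀ {o o′} r r′ → o ℕ.< o′ → run o r Above run o′ r′
  run-above zero    r′       o<o′ = []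
  run-above (suc r) zero     o<o′ = []
  run-above (suc r) (suc r′) o<o′ = o<o′ ∷ run-above r r′ (s≤s o<o′)
  next-above : ∀ o r r′ → run o r Above run (o ℕ.+ r) r′
  next-above o zero    r′ = []
  next-above o (suc r) r′ = run-above (suc r) r′
    (ℕₚ.≤-trans (s≤s (ℕₚ.m≤m+n o r)) (ℕₚ.≤-reflexive (sym (ℕₚ.+-suc o r))))
  columns : ∀ o λs → Linked _Above_ (rows o λs)
  columns o []            = []
  columns o (r ∷ [])      = [-]
  columns o (r ∷ r′ ∷ λs) = next-above o r r′ ∷ columns (o ℕ.+ r) (r′ ∷ λs)

s-1^-pos : ∀ {n} λs → sum λs ≡ n → 0ℚ < s λs (1^ n)
s-1^-pos {n} λs refl = ℚₚ.<-≤-trans (ℚₚ.positive⁻¹ 1ℚ) (ℚₚ.≤-trans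
  (ℚₚ.≤-reflexive (sym (𝟙-yes (content-≟ k (concat (rows 0 λs)) (1^ n)) content≡)))
  (ℚₚ.≤-trans
    (∑-≥-term (W k) {λ w → 𝟙 (content-≟ k w (1^ n))}
      (λ {w} _ → 𝟙-nonNeg (content-≟ k w (1^ n)))
      (∈ₚ.∈-map⁺ concat (∈ₚ.∈-filter⁺ semistandard?
        (rows-fillings 0 λs (ℕₚ.≤-reflexive (sym k≡n))) (rows-semistandard 0 λs))))
    (ℚₚ.≤-reflexive (sym (∑x-𝟙 W (1^ n) refl)))))
  where
  W : ℕ → List (List ℕ)
  W k = map concat (filter semistandard? (fillings k λs))
  k = length (1^ n)
  k≡n = Listₚ.length-replicate n {1}
  content≡ : content k (concat (rows 0 λs)) ≡ 1^ n
  content≡ = trans (cong₂ content k≡n (concat-rows 0 λs)) (content-run n)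

-- The coefficient of s_{1ⁿ} from the value at −1

∈-partitions⇒IsPartition : ∀ {n λs} → λs ∈ partitions n → IsPartition n λs
∈-partitions⇒IsPartition {n} λs∈ = proj₂ (∈ₚ.∈-filter⁻ (isPartition? n)
  {xs = concatMap (λ l → map toList (vectors (upTo (suc n)) l)) (upTo (suc n))} λs∈)

1^-or-ε≡0 : ∀ {λs} → All (1 ℕ.≤_) λs → λs ≡ 1^ (sum λs) ⊎ ε λs ≡ 0ℚ
1^-or-ε≡0 [] = inj₁ refl
1^-or-ε≡0 (_∷_ {suc zero} _ ps) with 1^-or-ε≡0 ps
... | inj₁ eq = inj₁ (cong (1 ∷_) eq)
... | inj₂ eq = inj₂ (trans (cong (- 1ℚ *_) eq) (ℚₚ.*-zeroʳ (- 1ℚ)))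
1^-or-ε≡0 (_∷_ {suc (suc _)} {λs} _ ps) = inj₂ (ℚₚ.*-zeroˡ (ε λs))

-- Only 1ⁿ contributes, so this is (-1)ⁿ. It is left unevaluated, as it occurs as the same factor
-- for both graphs in the ratio.
∑ε : ℕ → ℚ
∑ε n = ∑ (partitions n) ε

-- Summing the expansion over all exponents in m variables replaces each Schur function by its
-- tableau count, whose value at -1 is `ε`. Uniqueness of the extrapolated value identifies the
-- result with `a`.
coeff-1^ : ∀ {n F a} (E : SchurExpansion n F) → Ext (suc n) (total n F) a → a ≡ [s 1^ n ] E * ∑ε n
coeff-1^ {n} {F} {a} E ext = trans (Ext-unique (suc n) {total n F} {a} ext expansion) (begin
  (∑[ λs ∈ partitions n ] (coeff λs * ε λs))
    -- Where `ε` vanishes any coefficient may be substituted, so that of `1^ n` is written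
    -- everywhere and taken out of the sum.
    ≡⟨ ∑-cong-∈ (partitions n) only-1^ ⟩
  (∑[ λs ∈ partitions n ] (coeff (1^ n) * ε λs))
    ≡⟨ ∑-*ˡ (coeff (1^ n)) (partitions n) ε ⟩
  coeff (1^ n) * ∑ε n ∎)
  where
  open SchurExpansion E
  only-1^ : ∀ {λs} → λs ∈ partitions n → coeff λs * ε λs ≡ coeff (1^ n) * ε λs
  only-1^ {λs} λs∈ with ∈-partitions⇒IsPartition {n} λs∈
  ... | isPartition _ pos refl with 1^-or-ε≡0 pos
  ...   | inj₁ eq = cong (λ μ → coeff μ * ε λs) eq
  ...   | inj₂ eq = trans (cong (coeff λs *_) eq) (trans (ℚₚ.*-zeroʳ (coeff λs))
    (sym (trans (cong (coeff (1^ n) *_) eq) (ℚₚ.*-zeroʳ (coeff (1^ n))))))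
  total-F : ∀ m → (∑[ λs ∈ partitions n ] (coeff λs * tableaux λs m)) ≡ total n F m
  total-F m = begin
    (∑[ λs ∈ partitions n ] (coeff λs * tableaux λs m))
      ≡⟨ ∑-cong-∈ (partitions n) (λ {λs} λs∈ → trans
           (cong (coeff λs *_) (sym (total-s λs (IsPartition.size (∈-partitions⇒IsPartition {n} λs∈)) m)))
           (sym (∑-*ˡ (coeff λs) box (s λs)))) ⟩
    (∑[ λs ∈ partitions n ] ∑[ α ∈ box ] (coeff λs * s λs α))
      ≡⟨ ∑-swap (partitions n) box (λ λs α → coeff λs * s λs α) ⟩
    (∑[ α ∈ box ] ∑[ λs ∈ partitions n ] (coeff λs * s λs α))
      ≡⟨ ∑-cong box (λ α → sym (expands α)) ⟩
    total n F m ∎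
    where box = words (upTo (suc n)) m
  expansion : Ext (suc n) (total n F) (∑[ λs ∈ partitions n ] (coeff λs * ε λs))
  expansion = Ext-cong (suc n) {λ m → ∑[ λs ∈ partitions n ] (coeff λs * tableaux λs m)} {total n F}
    {∑[ λs ∈ partitions n ] (coeff λs * ε λs)} total-F refl
    (Ext-∑ (suc n) (partitions n) {λ λs m → coeff λs * tableaux λs m} {λ λs → coeff λs * ε λs}
      λ {λs} λs∈ → let isPartition dec _ size = ∈-partitions⇒IsPartition {n} λs∈ in
        Ext-* (suc n) (coeff λs) {tableaux λs} {ε λs}
          (tableaux-Ext (suc n) λs (Linked⇒Decreasing dec) (s≤s (ℕₚ.≤-reflexive size))))

-- Comparing a connected graph with a tree

sign-involutive : ∀ n → sign n * sign n ≡ 1ℚ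
sign-involutive zero    = refl
sign-involutive (suc n) = trans
  (solve 1 (λ x → con (- 1ℚ) :* x :* (con (- 1ℚ) :* x) := x :* x) refl (sign n)) (sign-involutive n)

pow2-pos : ∀ n → 0ℚ < pow2 n
pow2-pos zero    = ℚₚ.positive⁻¹ 1ℚ
pow2-pos (suc n) = ℚₚ.+-mono-< (pow2-pos n) (pow2-pos n)

-- The values at -1 give σ 2ⁿ⁻¹ = c′ K for the tree and σ b = c K for `H`, n being the number of
-- vertices. Multiplying the first by q = c / c′ yields q 2ⁿ⁻¹ = b without division by K, and b is
-- at least 2ⁿ⁻¹.
ratio-≥1 : ∀ {n} {T H : Graph n} → IsTree T → Connected H →
  (E : SchurExpansion n (X H)) (E′ : SchurExpansion n (X T)) .{{_ : ℚ.NonZero ([s 1^ n ] E′)}} →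
  1ℚ ≤ [s 1^ n ] E ℚ.÷ [s 1^ n ] E′
ratio-≥1 {zero} t conn E E′ = contradiction (Connected.nonEmpty conn) λ ()
ratio-≥1 {suc n} {T} {H} t conn E E′ = ℚₚ.*-cancelʳ-≤-pos (pow2 n) {{ℚ.positive (pow2-pos n)}}
  (ℚₚ.≤-trans (ℚₚ.≤-reflexive (ℚₚ.*-identityˡ (pow2 n)))
    (ℚₚ.≤-trans pow2≤b (ℚₚ.≤-reflexive (sym q*pow2≡b))))
  where
  σ  = sign (suc n)
  K  = ∑ε (suc n)
  c  = [s 1^ (suc n) ] E
  c′ = [s 1^ (suc n) ] E′
  q  = c ℚ.÷ c′
  b = proj₁ (total-connected conn)
  pow2≤b = proj₂ (proj₂ (total-connected conn))
  q*c′≡c : q * c′ ≡ c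
  q*c′≡c = trans (ℚₚ.*-assoc c (ℚ.1/ c′) c′)
    (trans (cong (c *_) (ℚₚ.*-inverseˡ c′)) (ℚₚ.*-identityʳ c))
  q*pow2≡b : q * pow2 n ≡ b
  q*pow2≡b = begin
    q * pow2 n
      ≡⟨ sym (ℚₚ.*-identityˡ (q * pow2 n)) ⟩
    1ℚ * (q * pow2 n)
      ≡⟨ cong (_* (q * pow2 n)) (sym (sign-involutive (suc n))) ⟩
    σ * σ * (q * pow2 n)
      ≡⟨ solve 3 (λ s q p → s :* s :* (q :* p) := s :* (q :* (s :* p))) refl σ q (pow2 n) ⟩
    σ * (q * (σ * pow2 n))
      ≡⟨ cong (λ x → σ * (q * x)) (coeff-1^ {a = σ * pow2 n} E′ (total-tree t)) ⟩
    σ * (q * (c′ * K))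
      ≡⟨ cong (σ *_) (trans (sym (ℚₚ.*-assoc q c′ K)) (cong (_* K) q*c′≡c)) ⟩
    σ * (c * K)
      ≡⟨ cong (σ *_) (sym (coeff-1^ {a = σ * b} E (proj₁ (proj₂ (total-connected conn))))) ⟩
    σ * (σ * b)
      ≡⟨ trans (sym (ℚₚ.*-assoc σ σ b)) (cong (_* b) (sign-involutive (suc n))) ⟩
    1ℚ * b
      ≡⟨ ℚₚ.*-identityˡ b ⟩
    b ∎

-- Every Schur function contains x₀ ⋯ xₙ₋₁, as a standard tableau shows.

schurPositive-vanish : ∀ {n F} → SchurPositive n F → F (1^ n) ≤ 0ℚ → F ≈ λ _ → 0ℚ
schurPositive-vanish {n} {F} (P , P≥0) F≤0 α = trans (expands α)
  (∑-vanish (partitions n) λ {λs} λs∈ →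
    trans (cong (_* s λs α) (coeff≡0 λs∈)) (ℚₚ.*-zeroˡ (s λs α)))
  where
  open SchurExpansion P
  s>0 : ∀ {λs} → λs ∈ partitions n → ℚ.Positive (s λs (1^ n))
  s>0 {λs} λs∈ = ℚ.positive (s-1^-pos λs (IsPartition.size (∈-partitions⇒IsPartition {n} λs∈)))
  term≥0 : ∀ {λs} → λs ∈ partitions n → 0ℚ ≤ coeff λs * s λs (1^ n)
  term≥0 {λs} λs∈ = ℚₚ.≤-trans (ℚₚ.≤-reflexive (sym (ℚₚ.*-zeroˡ (s λs (1^ n)))))
    (ℚₚ.*-monoʳ-≤-nonNeg (s λs (1^ n)) {{ℚₚ.pos⇒nonNeg (s λs (1^ n)) {{s>0 λs∈}}}} (P≥0 λs λs∈))
  coeff≡0 : ∀ {λs} → λs ∈ partitions n → coeff λs ≡ 0ℚ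
  coeff≡0 {λs} λs∈ = ℚₚ.≤-antisym
    (ℚₚ.*-cancelʳ-≤-pos (s λs (1^ n)) {{s>0 λs∈}} (ℚₚ.≤-trans
      (∑-≥-term (partitions n) {λ μ → coeff μ * s μ (1^ n)} term≥0 λs∈)
      (ℚₚ.≤-trans (ℚₚ.≤-reflexive (sym (expands (1^ n))))
        (ℚₚ.≤-trans F≤0 (ℚₚ.≤-reflexive (sym (ℚₚ.*-zeroˡ (s λs (1^ n)))))))))
    (P≥0 λs λs∈)

≥ₛ-tree : ∀ {n} {T H : Graph n} → IsTree T → Connected H → H ≥ₛ T → X H ≈ X T
≥ₛ-tree {n} {T} {H} t conn (E , E′ , nz , pos) α = trans (XH≡q*XT α)
  (trans (cong (_* X T α) q≡1) (ℚₚ.*-identityˡ (X T α)))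
  where
  q = ([s 1^ n ] E ℚ.÷ [s 1^ n ] E′) {{nz}}
  M = X T (1^ n)
  XH≡M : X H (1^ n) ≡ M
  XH≡M = trans (X-1^ H) (sym (X-1^ T))
  M>0 : ℚ.Positive M
  M>0 = ℚ.positive (X-1^-pos T)
  M≤q*M : M ≤ q * M
  M≤q*M = ℚₚ.≤-trans (ℚₚ.≤-reflexive (sym (ℚₚ.*-identityˡ M)))
    (ℚₚ.*-monoʳ-≤-nonNeg M {{ℚₚ.pos⇒nonNeg M {{M>0}}}} (ratio-≥1 t conn E E′ {{nz}}))
  difference≤0 : X H (1^ n) - q * M ≤ 0ℚ
  difference≤0 = ℚₚ.≤-trans (ℚₚ.≤-reflexive (cong (_- q * M) XH≡M))
    (ℚₚ.≤-trans (ℚₚ.+-monoˡ-≤ (- (q * M)) M≤q*M) (ℚₚ.≤-reflexive (ℚₚ.+-inverseʳ (q * M))))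
  XH≡q*XT : ∀ α → X H α ≡ q * X T α
  XH≡q*XT α = begin
    X H α                           ≡⟨ solve 2 (λ x y → x := x :- y :+ y) refl (X H α) (q * X T α) ⟩
    X H α - q * X T α + q * X T α   ≡⟨ cong (_+ q * X T α) (schurPositive-vanish pos difference≤0 α) ⟩
    0ℚ + q * X T α                  ≡⟨ ℚₚ.+-identityˡ (q * X T α) ⟩
    q * X T α                       ∎
  -- At `1^ n` both series have the same positive coefficient M, so X H = q · X T gives M = q M and
  -- hence q ≤ 1.
  q≡1 : q ≡ 1ℚ
  q≡1 = ℚₚ.≤-antisym
    (ℚₚ.*-cancelʳ-≤-pos M {{M>0}} (ℚₚ.≤-reflexive
      (trans (sym (XH≡q*XT (1^ n))) (trans XH≡M (sym (ℚₚ.*-identityˡ M))))))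
    (ratio-≥1 t conn E E′ {{nz}})

proposition4p10 : (n : ℕ) (T : Graph n) (t : IsTree T) → Maximal (𝒮 n) (T , IsTree.connected t)
-- Since X H = X T, the given proof of H ≥ₛ T can be transported in both arguments at once, which
-- exchanges the two graphs.
proposition4p10 n T t (H , conn) (inj₁ H≥T) =
  ≥ₛ-resp-≈ {G = H} {T} {T} {H} H≈T (λ α → sym (H≈T α)) H≥T
  where H≈T = ≥ₛ-tree {T = T} {H} t conn H≥T
proposition4p10 n T t (H , conn) (inj₂ T≥H) = T≥H
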